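{- Let $0<\lambda<\tfrac12$, let $F_\lambda$ be the middle-$(1-2\lambda)$ Cantor set, let $F_\lambda^2=\{x^2:x\in F_\lambda\}$, and let $$D=\left\{\frac{x_1^2}{x_2}: x_1,x_2\in F_\lambda,\ x_2\neq 0\right\},\qquad K=\{k\ge 0: k\notin D\}.$$ Then: (i) $F_\lambda^2$ is not a self-similar set; (ii) if $\tfrac13\le\lambda<\tfrac12$, then $K=\emptyset$, i.e. $D=[0,+\infty)$; (iii) if $\tfrac{2-\sqrt2}{2}\le\lambda<\tfrac12$, then $D$ contains a closed interval of positive length.
   Context: For $0<\lambda<\tfrac12$, $F_\lambda\subset[0,1]$ is the unique nonempty compact set (attractor) satisfying $F_\lambda=f_0(F_\lambda)\cup f_1(F_\lambda)$, where $f_0(x)=\lambda x$ and $f_1(x)=\lambda x+(1-\lambda)$. A compact set $E\subset\mathbb R$ is self-similar if it is the attractor of a finite family (with at least two maps) of contracting similarities $x\mapsto r_ix+b_i$, $0<|r_i|<1$. The set $K$ is the set of slopes $k\ge 0$ for which the ray $y=kx$, $x>0$, does not meet $F_\lambda\times F_\lambda^2$. -}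

module Defs where

open import Level using (0ℓ)
open import Algebra.Bundles using (CommutativeRing)
open import Algebra.Core using (Op₁; Op₂)
open import Algebra.Definitions using (Congruent₁)
open import Algebra.Structures using (IsCommutativeRing)
open import Data.Fin.Base using (Fin; zero; suc)
open import Data.List.Base using (List)
open import Data.List.Relation.Unary.Any using (Any)
open import Data.Nat.Base as ℕ using (ℕ)
open import Data.Product.Base using (Σ-syntax; ∃-syntax; _×_)
open import Relation.Binary.Bundles using (TotalOrder)
open import Relation.Binary.Core using (Rel)
open import Relation.Binary.Structures using (IsTotalOrder)
open import Relation.Nullary.Negation.Core using (¬_)
open import Relation.Unary using (Pred; _∈_; _∉_; _≐_; Satisfiable)
import Algebra.Construct.NaturalChoice.Max as Max
import Relation.Binary.Construct.NonStrictToStrict as Strict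

-- The real numbers, axiomatised (up to isomorphism) as a complete ordered
-- field.  Equality is a setoid equality, so that the usual models (Cauchy
-- sequences, Dedekind cuts) qualify without quotient types.

record CompleteOrderedField : Set₁ where
  infix  9 _⁻¹
  infix  8 -_
  infixl 7 _*_
  infixl 6 _+_
  infix  4 _≈_ _≤_

  field
    Carrier : Set
    _≈_     : Rel Carrier 0ℓ
    _≤_     : Rel Carrier 0ℓ
    _+_     : Op₂ Carrier
    _*_     : Op₂ Carrier
    -_      : Op₁ Carrier
    -- Total for convenience; the value at 0# is unspecified.
    _⁻¹     : Op₁ Carrier
    0#      : Carrier
    1#      : Carrier

    isCommutativeRing : IsCommutativeRing _≈_ _+_ _*_ -_ 0# 1#
    0≉1               : ¬ (0# ≈ 1#)
    ⁻¹-cong           : Congruent₁ _≈_ _⁻¹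
    ⁻¹-inverseʳ       : ∀ {x} → ¬ (x ≈ 0#) → x * x ⁻¹ ≈ 1#

    isTotalOrder      : IsTotalOrder _≈_ _≤_
    +-monoˡ-≤         : ∀ z {x y} → x ≤ y → x + z ≤ y + z
    *-nonNegative     : ∀ {x y} → 0# ≤ x → 0# ≤ y → 0# ≤ x * y

  UpperBound : Pred Carrier 0ℓ → Pred Carrier 0ℓ
  UpperBound P u = ∀ x → x ∈ P → x ≤ u

  Supremum : Pred Carrier 0ℓ → Pred Carrier 0ℓ
  Supremum P s = s ∈ UpperBound P × (∀ u → u ∈ UpperBound P → s ≤ u)

  field
    complete : (P : Pred Carrier 0ℓ) →
               Satisfiable P → Satisfiable (UpperBound P) → Satisfiable (Supremum P)

  commutativeRing : CommutativeRing 0ℓ 0ℓ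
  commutativeRing = record { isCommutativeRing = isCommutativeRing }

  totalOrder : TotalOrder 0ℓ 0ℓ 0ℓ
  totalOrder = record { isTotalOrder = isTotalOrder }

  open CommutativeRing commutativeRing public using (_≉_; _-_)
  open Strict _≈_ _≤_ public using (_<_)
  open Max totalOrder public using (_⊔_)

  infixl 7 _/_

  _/_ : Op₂ Carrier
  x / y = x * y ⁻¹

  ∣_∣ : Op₁ Carrier
  ∣ x ∣ = x ⊔ (- x)

  2# 3# : Carrier
  2# = 1# + 1#
  3# = 2# + 1#

  -- s = √a
  IsSqrt : Carrier → Carrier → Set
  IsSqrt a s = 0# ≤ s × s * s ≈ a

module Fractal (R : CompleteOrderedField) where
  open CompleteOrderedField R renaming (Carrier to ℝ)

  -- Open sets are automatically closed under _≈_.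
  Open : Pred ℝ 0ℓ → Set
  Open U = ∀ x → x ∈ U → ∃[ ε ] 0# < ε × (∀ y → ∣ y - x ∣ < ε → y ∈ U)

  Compact : Pred ℝ 0ℓ → Set₁
  Compact E = {I : Set} (U : I → Pred ℝ 0ℓ) → (∀ i → Open (U i)) →
              (∀ x → x ∈ E → ∃[ i ] x ∈ U i) →
              Σ[ is ∈ List I ] (∀ x → x ∈ E → Any (λ i → x ∈ U i) is)

  -- The union of the images f i (E).
  ⋃-image : ∀ {n} → (Fin n → ℝ → ℝ) → Pred ℝ 0ℓ → Pred ℝ 0ℓ
  ⋃-image f E y = ∃[ i ] ∃[ x ] x ∈ E × y ≈ f i x

  -- The last clause forces E to be closed under _≈_.
  IsAttractor : ∀ {n} → (Fin n → ℝ → ℝ) → Pred ℝ 0ℓ → Set₁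
  IsAttractor f E = Satisfiable E × Compact E × E ≐ ⋃-image f E

  SelfSimilar : Pred ℝ 0ℓ → Set₁
  SelfSimilar E =
    Σ[ n ∈ ℕ ] Σ[ r ∈ (Fin n → ℝ) ] Σ[ b ∈ (Fin n → ℝ) ]
      2 ℕ.≤ n ×
      (∀ i → 0# < ∣ r i ∣ × ∣ r i ∣ < 1#) ×
      IsAttractor (λ i x → r i * x + b i) E

  cantorMaps : ℝ → Fin 2 → ℝ → ℝ
  cantorMaps ƛ zero       x = ƛ * x
  cantorMaps ƛ (suc zero) x = ƛ * x + (1# - ƛ)

  -- For 0 < ƛ < 1/2 the maps are contractions, and exactly one set F
  -- (up to _≐_) satisfies this.
  IsCantorSet : ℝ → Pred ℝ 0ℓ → Set₁
  IsCantorSet ƛ F = IsAttractor (cantorMaps ƛ) F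

  squares : Pred ℝ 0ℓ → Pred ℝ 0ℓ
  squares F y = ∃[ x ] x ∈ F × y ≈ x * x

  D : Pred ℝ 0ℓ → Pred ℝ 0ℓ
  D F t = ∃[ x₁ ] ∃[ x₂ ] x₁ ∈ F × x₂ ∈ F × x₂ ≉ 0# × t ≈ (x₁ * x₁) / x₂

  K : Pred ℝ 0ℓ → Pred ℝ 0ℓ
  K F k = 0# ≤ k × k ∉ D F

{-# OPTIONS --safe #-}

-- (i) Put E = F². Some map of a self-similarity system for E sends E onto a
-- subset with endpoint 1; let ρ be its ratio. Among the gaps of E only the
-- central one, between ƛ² and (1 - ƛ)², has length ≥ 1 - 2ƛ. For δ = ƛⁿ the gap
-- ((1 - δ + ƛδ)² , (1 - ƛδ)²) occupies exactly the proportion 1 - 2ƛ of the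
-- interval [(1 - δ)² , 1]. So if the image lies in that interval and straddles
-- that gap, the preimage of the gap must be the central gap, and its position
-- is wrong. Hence the image lies in [(1 - ƛδ)² , 1], and by induction ρ ≤ 2ƛⁿ
-- for all n, which is absurd.
--
-- (ii), (iii) A product of two basic intervals of F ∩ [1 - ƛ , 1], of equal
-- length and meeting the curve x² = t y, contains a product of two basic
-- intervals of the next generation meeting it, because ƛ is large relative to
-- 1 - 2ƛ. Nested squares then yield a point of F × F on the curve whenever
-- (1 - ƛ)² ≤ t ≤ 1 / (1 - ƛ) (with 2 (1 - 2ƛ) ≤ t if ƛ < 1/3). For ƛ ≥ 1/3 this
-- range of t contains [α , α / ƛ] with α = (1 - ƛ)², and D is invariant under
-- multiplication and division by ƛ.

module Submission where

open import Defs
open import Level using (0ℓ)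
open import Axiom.ExcludedMiddle using (ExcludedMiddle)
open import Data.Product.Base using (∃-syntax; _×_; _,_; proj₁; proj₂)
open import Relation.Nullary.Negation.Core using (¬_)
open import Relation.Unary using (Pred; _∈_; _≐_; Empty; _⊆_)

open import Algebra.Bundles using (CommutativeRing)
open import Algebra.Solver.Ring.AlmostCommutativeRing
  using (fromCommutativeRing; _-Raw-AlmostCommutative⟶_)
import Algebra.Solver.Ring as RingSolver
open import Data.Empty using (⊥; ⊥-elim)
open import Data.Fin.Base using (Fin)
open import Data.Integer.Base as ℤ using (ℤ; +_; -[1+_])
import Data.Integer.Properties as ℤₚ
open import Data.List.Base using (List; []; _∷_)
open import Data.List.Relation.Unary.Any using (Any; here; there)
open import Data.Maybe.Base using (Maybe; just; nothing)
open import Data.Nat.Base as ℕ using (ℕ; zero; suc)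
import Data.Nat.Properties as ℕₚ
open import Data.Sum.Base using (_⊎_; inj₁; inj₂; map₂)
open import Relation.Binary.Bundles using (TotalOrder)
open import Relation.Binary.PropositionalEquality.Core as ≡ using (_≡_)
open import Relation.Nullary.Decidable.Core using (yes; no)

-- Integer coefficients for the ring solver over a commutative ring.

module IntegerCoefficients (CR : CommutativeRing 0ℓ 0ℓ) where
  open CommutativeRing CR
  open import Algebra.Properties.Ring ring
    using (-‿distribˡ-*; -‿distribʳ-*; -0#≈0#; -‿involutive; -‿+-comm)
  open import Algebra.Properties.Semiring.Mult.TCOptimised semiring
    using (1+×; ×-homo-+; ×1-homo-*) renaming (_×_ to _·_)
  open import Relation.Binary.Reasoning.Setoid setoid
  open import Algebra.Properties.CommutativeSemigroup +-commutativeSemigroup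
    using (interchange)

  ⟦_⟧ℤ : ℤ → Carrier
  ⟦ + n      ⟧ℤ = n · 1#
  ⟦ -[1+ n ] ⟧ℤ = - (suc n · 1#)

  ⟦⟧-cong : ∀ {i j} → i ≡ j → ⟦ i ⟧ℤ ≈ ⟦ j ⟧ℤ
  ⟦⟧-cong ≡.refl = refl

  -‿homo : ∀ i → ⟦ ℤ.- i ⟧ℤ ≈ - ⟦ i ⟧ℤ
  -‿homo (+ zero)   = sym -0#≈0#
  -‿homo (+ suc n)  = refl
  -‿homo -[1+ n ]   = sym (-‿involutive _)

  ⊖-homo : ∀ m n → ⟦ m ℤ.⊖ n ⟧ℤ ≈ m · 1# - n · 1#
  ⊖-homo m zero = begin
    m · 1#         ≈⟨ +-identityʳ _ ⟨
    m · 1# + 0#    ≈⟨ +-congˡ -0#≈0# ⟨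
    m · 1# - 0#    ∎
  ⊖-homo zero (suc n) = sym (+-identityˡ _)
  ⊖-homo (suc m) (suc n) = begin
    ⟦ suc m ℤ.⊖ suc n ⟧ℤ               ≈⟨ ⟦⟧-cong (ℤₚ.[1+m]⊖[1+n]≡m⊖n m n) ⟩
    ⟦ m ℤ.⊖ n ⟧ℤ                       ≈⟨ ⊖-homo m n ⟩
    m · 1# - n · 1#                    ≈⟨ +-identityˡ _ ⟨
    0# + (m · 1# - n · 1#)             ≈⟨ +-congʳ (-‿inverseʳ 1#) ⟨
    (1# - 1#) + (m · 1# - n · 1#)      ≈⟨ interchange _ _ _ _ ⟩
    (1# + m · 1#) + (- 1# - n · 1#)    ≈⟨ +-congˡ (-‿+-comm _ _) ⟩
    (1# + m · 1#) - (1# + n · 1#)      ≈⟨ +-cong (1+× m 1#) (-‿cong (1+× n 1#)) ⟨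
    suc m · 1# - suc n · 1#            ∎

  +-homo : ∀ i j → ⟦ i ℤ.+ j ⟧ℤ ≈ ⟦ i ⟧ℤ + ⟦ j ⟧ℤ
  +-homo (+ m)    (+ n)    = ×-homo-+ 1# m n
  +-homo (+ m)    -[1+ n ] = ⊖-homo m (suc n)
  +-homo -[1+ m ] (+ n)    = trans (⊖-homo n (suc m)) (+-comm _ _)
  +-homo -[1+ m ] -[1+ n ] = begin
    ⟦ -[1+ m ] ℤ.+ -[1+ n ] ⟧ℤ            ≈⟨ ⟦⟧-cong (ℤₚ.neg-distrib-+ (+ suc m) (+ suc n)) ⟨
    ⟦ ℤ.- (+ suc m ℤ.+ + suc n) ⟧ℤ        ≈⟨ -‿homo (+ suc m ℤ.+ + suc n) ⟩
    - ((suc m ℕ.+ suc n) · 1#)            ≈⟨ -‿cong (×-homo-+ 1# (suc m) (suc n)) ⟩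
    - (suc m · 1# + suc n · 1#)           ≈⟨ -‿+-comm _ _ ⟨
    - (suc m · 1#) - suc n · 1#           ∎

  *-homo-ℕ : ∀ m n → ⟦ + m ℤ.* + n ⟧ℤ ≈ ⟦ + m ⟧ℤ * ⟦ + n ⟧ℤ
  *-homo-ℕ m n = trans (⟦⟧-cong (≡.sym (ℤₚ.pos-* m n))) (×1-homo-* m n)

  *-homo : ∀ i j → ⟦ i ℤ.* j ⟧ℤ ≈ ⟦ i ⟧ℤ * ⟦ j ⟧ℤ
  *-homo (+ m)    (+ n)    = *-homo-ℕ m n
  *-homo (+ m)    -[1+ n ] = begin
    ⟦ + m ℤ.* -[1+ n ] ⟧ℤ           ≈⟨ ⟦⟧-cong (ℤₚ.neg-distribʳ-* (+ m) (+ suc n)) ⟨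
    ⟦ ℤ.- (+ m ℤ.* + suc n) ⟧ℤ      ≈⟨ -‿homo (+ m ℤ.* + suc n) ⟩
    - ⟦ + m ℤ.* + suc n ⟧ℤ          ≈⟨ -‿cong (*-homo-ℕ m (suc n)) ⟩
    - (m · 1# * (suc n · 1#))       ≈⟨ -‿distribʳ-* _ _ ⟩
    m · 1# * - (suc n · 1#)         ∎
  *-homo -[1+ m ] (+ n)    = begin
    ⟦ -[1+ m ] ℤ.* + n ⟧ℤ           ≈⟨ ⟦⟧-cong (ℤₚ.neg-distribˡ-* (+ suc m) (+ n)) ⟨
    ⟦ ℤ.- (+ suc m ℤ.* + n) ⟧ℤ      ≈⟨ -‿homo (+ suc m ℤ.* + n) ⟩
    - ⟦ + suc m ℤ.* + n ⟧ℤ          ≈⟨ -‿cong (*-homo-ℕ (suc m) n) ⟩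
    - (suc m · 1# * (n · 1#))       ≈⟨ -‿distribˡ-* _ _ ⟩
    - (suc m · 1#) * (n · 1#)       ∎
  *-homo -[1+ m ] -[1+ n ] = begin
    ⟦ -[1+ m ] ℤ.* -[1+ n ] ⟧ℤ           ≈⟨ *-homo-ℕ (suc m) (suc n) ⟩
    suc m · 1# * (suc n · 1#)            ≈⟨ -‿involutive _ ⟨
    - - (suc m · 1# * (suc n · 1#))      ≈⟨ -‿cong (-‿distribʳ-* _ _) ⟩
    - (suc m · 1# * - (suc n · 1#))      ≈⟨ -‿distribˡ-* _ _ ⟩
    - (suc m · 1#) * - (suc n · 1#)      ∎

  -- Coefficients in ℤ have a computable equality test, so the solver can collect and cancel terms
  -- over an abstract ring.
  ℤ⟶CR : ℤ.+-*-rawRing -Raw-AlmostCommutative⟶ fromCommutativeRing CR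
  ℤ⟶CR = record
    { ⟦_⟧    = ⟦_⟧ℤ
    ; +-homo = +-homo
    ; *-homo = *-homo
    ; -‿homo = -‿homo
    ; 0-homo = refl
    ; 1-homo = refl
    }

  _≟ℤ_ : ∀ i j → Maybe (⟦ i ⟧ℤ ≈ ⟦ j ⟧ℤ)
  i ≟ℤ j with i ℤₚ.≟ j
  ... | yes i≡j = just (⟦⟧-cong i≡j)
  ... | no  _   = nothing

  open RingSolver ℤ.+-*-rawRing (fromCommutativeRing CR) ℤ⟶CR _≟ℤ_ public
    using (Polynomial; solve; _:=_; con; _:+_; _:*_; _:-_; :-_)

  -- With the optimised multiple `_·_`, these constants evaluate definitionally to `0#`, `1#`, `2#`
  -- and `3#`, so certificates can mention the numerals directly.
  :0 :1 :2 :3 : ∀ {n} → Polynomial n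
  :0 = con (+ 0)
  :1 = con (+ 1)
  :2 = con (+ 2)
  :3 = con (+ 3)

-- Ordered field inequalities, square roots and nested intervals.

module OrderedField (em : ExcludedMiddle 0ℓ) (R : CompleteOrderedField) where
  open CompleteOrderedField R renaming (Carrier to ℝ) public
  open CommutativeRing commutativeRing public
    using (refl; sym; trans; +-cong; +-congˡ; +-congʳ; *-cong; *-congˡ; *-congʳ;
           -‿cong; *-comm; semiring; setoid)
  open TotalOrder totalOrder public
    using (antisym; total)
    renaming (refl to ≤-refl; reflexive to ≤-reflexive; trans to ≤-trans;
              ≤-respˡ-≈ to ≤-respˡ; ≤-respʳ-≈ to ≤-respʳ)
  open IntegerCoefficients commutativeRing public
    using (Polynomial; solve; _:=_; _:+_; _:*_; _:-_; :-_; :0; :1; :2; :3)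
  open import Algebra.Construct.NaturalChoice.Max totalOrder using (maxOperator)
  open import Algebra.Construct.NaturalChoice.MaxOp maxOperator public
    using (x≤x⊔y; x≤y⊔x; ⊔-lub)

  ≤∨> : ∀ x y → x ≤ y ⊎ y < x
  ≤∨> x y with total x y | em {P = y ≈ x}
  ... | inj₁ x≤y | _       = inj₁ x≤y
  ... | inj₂ y≤x | yes y≈x = inj₁ (≤-reflexive (sym y≈x))
  ... | inj₂ y≤x | no  y≉x = inj₂ (y≤x , y≉x)

  ≤∧<⇒⊥ : ∀ {x y} → x ≤ y → y < x → ⊥
  ≤∧<⇒⊥ x≤y (y≤x , y≉x) = y≉x (antisym y≤x x≤y)

  ≮⇒≥ : ∀ {x y} → ¬ (y < x) → x ≤ y
  ≮⇒≥ {x} {y} y≮x with ≤∨> x y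
  ... | inj₁ x≤y = x≤y
  ... | inj₂ y<x = ⊥-elim (y≮x y<x)

  -- Inequalities are proved by certificates: the difference of the two sides
  -- is identified, by the ring solver, with an expression that is visibly
  -- nonnegative (or positive).

  ≤-diff : ∀ {x y} → x ≤ y → 0# ≤ y - x
  ≤-diff {x} {y} x≤y =
    ≤-respˡ (solve 1 (λ x → x :- x := :0) refl x) (+-monoˡ-≤ (- x) x≤y)

  ≤-by : ∀ {x y e} → 0# ≤ e → e ≈ y - x → x ≤ y
  ≤-by {x} {y} 0≤e e≈y-x =
    ≤-respˡ (solve 1 (λ x → :0 :+ x := x) refl x)
      (≤-respʳ (trans (+-congʳ e≈y-x)
                      (solve 2 (λ x y → y :- x :+ x := y) refl x y))
        (+-monoˡ-≤ x 0≤e))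

  <-diff : ∀ {x y} → x < y → 0# < y - x
  <-diff {x} {y} (x≤y , x≉y) = ≤-diff x≤y , λ 0≈y-x → x≉y
    (trans (solve 1 (λ x → x := :0 :+ x) refl x)
      (trans (+-congʳ 0≈y-x) (solve 2 (λ x y → y :- x :+ x := y) refl x y)))

  <-by : ∀ {x y e} → 0# < e → e ≈ y - x → x < y
  <-by {x} {y} (0≤e , 0≉e) e≈y-x = ≤-by 0≤e e≈y-x , λ x≈y → 0≉e
    (sym (trans e≈y-x (trans (+-congʳ (sym x≈y)) (solve 1 (λ x → x :- x := :0) refl x))))

  infixl 6 _⊕_ _⊞_
  infixl 7 _⊗_ _⊠_

  -- The circled operations combine nonnegative certificates; the squared ones keep strict
  -- positivity. A certificate term thus has the same shape as the expression handed to the solver.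
  _⊕_ : ∀ {x y} → 0# ≤ x → 0# ≤ y → 0# ≤ x + y
  _⊕_ {x} {y} 0≤x 0≤y = ≤-trans 0≤y
    (≤-by 0≤x (solve 2 (λ x y → x := x :+ y :- y) refl x y))

  _⊗_ : ∀ {x y} → 0# ≤ x → 0# ≤ y → 0# ≤ x * y
  _⊗_ = *-nonNegative

  _⊞_ : ∀ {x y} → 0# < x → 0# ≤ y → 0# < x + y
  _⊞_ {x} {y} 0<x 0≤y = proj₁ 0<x ⊕ 0≤y , λ 0≈x+y → ≤∧<⇒⊥
    (≤-by 0≤y (trans (solve 2 (λ x y → y := x :+ y :- x) refl x y) (+-congʳ (sym 0≈x+y))))
    0<x

  0<⇒≉0 : ∀ {x} → 0# < x → x ≉ 0#
  0<⇒≉0 (_ , 0≉x) x≈0 = 0≉x (sym x≈0)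

  _⊠_ : ∀ {x y} → 0# < x → 0# < y → 0# < x * y
  _⊠_ {x} {y} 0<x 0<y = proj₁ 0<x ⊗ proj₁ 0<y , λ 0≈xy → proj₂ 0<y
    (trans (solve 1 (λ z → :0 := :0 :* z) refl (x ⁻¹))
      (trans (*-congʳ 0≈xy)
        (trans (solve 3 (λ x y z → x :* y :* z := y :* (x :* z)) refl x y (x ⁻¹))
          (trans (*-congˡ (⁻¹-inverseʳ (0<⇒≉0 0<x)))
            (solve 1 (λ y → y :* :1 := y) refl y)))))

  -- Refutations in certificate form: the contradictory hypotheses are combined into a visibly
  -- positive expression which the solver finds to be identically 0.
  absurd : ∀ {A : Set} {e} → 0# < e → e ≈ 0# → A
  absurd 0<e e≈0 = ⊥-elim (0<⇒≉0 0<e e≈0)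

  0≤x² : ∀ x → 0# ≤ x * x
  0≤x² x with total 0# x
  ... | inj₁ 0≤x = 0≤x ⊗ 0≤x
  ... | inj₂ x≤0 = ≤-respʳ (solve 1 (λ x → (:0 :- x) :* (:0 :- x) := x :* x) refl x)
                     (≤-diff x≤0 ⊗ ≤-diff x≤0)

  0<1 : 0# < 1#
  0<1 = ≤-respʳ (solve 0 (:1 :* :1 := :1) refl) (0≤x² 1#) , 0≉1

  0<2 : 0# < 2#
  0<2 = 0<1 ⊞ proj₁ 0<1

  0<3 : 0# < 3#
  0<3 = 0<2 ⊞ proj₁ 0<1

  ≤-<-trans : ∀ {x y z} → x ≤ y → y < z → x < z
  ≤-<-trans {x} {y} {z} x≤y y<z = <-by (<-diff y<z ⊞ ≤-diff x≤y)
    (solve 3 (λ x y z → z :- y :+ (y :- x) := z :- x) refl x y z)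

  <-≤-trans : ∀ {x y z} → x < y → y ≤ z → x < z
  <-≤-trans {x} {y} {z} x<y y≤z = <-by (<-diff x<y ⊞ ≤-diff y≤z)
    (solve 3 (λ x y z → y :- x :+ (z :- y) := z :- x) refl x y z)

  *-monoˡ-≤ : ∀ {c x y} → 0# ≤ c → x ≤ y → c * x ≤ c * y
  *-monoˡ-≤ {c} {x} {y} 0≤c x≤y = ≤-by (0≤c ⊗ ≤-diff x≤y)
    (solve 3 (λ c x y → c :* (y :- x) := c :* y :- c :* x) refl c x y)

  *-cancelˡ-≤ : ∀ {c x y} → 0# < c → c * x ≤ c * y → x ≤ y
  *-cancelˡ-≤ {c} {x} {y} 0<c cx≤cy = ≮⇒≥ λ y<x →
    absurd (0<c ⊠ <-diff y<x ⊞ ≤-diff cx≤cy)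
      (solve 3 (λ c x y → c :* (x :- y) :+ (c :* y :- c :* x) := :0) refl c x y)

  *-cancelˡ-< : ∀ {c x y} → 0# < c → c * x < c * y → x < y
  *-cancelˡ-< {c} {x} {y} 0<c cx<cy =
    *-cancelˡ-≤ 0<c (proj₁ cx<cy) , λ x≈y → proj₂ cx<cy (*-congˡ x≈y)

  *-/-cancel : ∀ x {y} → y ≉ 0# → y * (x / y) ≈ x
  *-/-cancel x {y} y≉0 =
    trans (solve 3 (λ x y z → y :* (x :* z) := x :* (y :* z)) refl x y (y ⁻¹))
      (trans (*-congˡ (⁻¹-inverseʳ y≉0)) (solve 1 (λ x → x :* :1 := x) refl x))

  ∣x∣<ε⇒x<ε : ∀ {x ε} → ∣ x ∣ < ε → x < ε
  ∣x∣<ε⇒x<ε {x} = ≤-<-trans (x≤x⊔y x (- x))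

  ∣x∣<ε⇒-x<ε : ∀ {x ε} → ∣ x ∣ < ε → - x < ε
  ∣x∣<ε⇒-x<ε {x} = ≤-<-trans (x≤y⊔x x (- x))

  ²-mono-≤ : ∀ {x y} → 0# ≤ x → x ≤ y → x * x ≤ y * y
  ²-mono-≤ {x} {y} 0≤x x≤y = ≤-by (≤-diff x≤y ⊗ (≤-trans 0≤x x≤y ⊕ 0≤x))
    (solve 2 (λ x y → (y :- x) :* (y :+ x) := y :* y :- x :* x) refl x y)

  ²-mono-< : ∀ {x y} → 0# ≤ x → x < y → x * x < y * y
  ²-mono-< {x} {y} 0≤x x<y = <-by (<-diff x<y ⊠ (≤-<-trans 0≤x x<y ⊞ 0≤x))
    (solve 2 (λ x y → (y :- x) :* (y :+ x) := y :* y :- x :* x) refl x y)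

  ²-cancel-≤ : ∀ {x y} → 0# ≤ y → x * x ≤ y * y → x ≤ y
  ²-cancel-≤ 0≤y x²≤y² = ≮⇒≥ λ y<x → ≤∧<⇒⊥ x²≤y² (²-mono-< 0≤y y<x)

  sqrt : ∀ c → 0# ≤ c → ∃[ s ] IsSqrt c s
  sqrt c 0≤c = s , 0≤s , antisym s²≤c c≤s²
    where
    S : Pred ℝ 0ℓ
    S x = 0# ≤ x × x * x ≤ c

    0∈S : 0# ∈ S
    0∈S = ≤-refl , ≤-respˡ (solve 0 (:0 := :0 :* :0) refl) 0≤c

    bound : ∀ x → x ∈ S → x ≤ 1# + c
    bound x (0≤x , x²≤c) = ≮⇒≥ λ 1+c<x → absurd
      (0<1 ⊞ (0≤c ⊕ 0≤c ⊗ 0≤c ⊕ ≤-diff x²≤c ⊕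
        proj₁ (<-diff 1+c<x) ⊗ (0≤x ⊕ (proj₁ 0<1 ⊕ 0≤c))))
      (solve 2 (λ c x → :1 :+ (c :+ c :* c :+ (c :- x :* x) :+
        (x :- (:1 :+ c)) :* (x :+ (:1 :+ c))) := :0) refl c x)

    sup : ∃[ s ] Supremum S s
    sup = complete S (0# , 0∈S) (1# + c , bound)

    s : ℝ
    s = proj₁ sup

    0≤s : 0# ≤ s
    0≤s = proj₁ (proj₂ sup) 0# 0∈S

    -- The Newton iterate x = (s² + c) / 2s is an upper bound of S.
    s²≤c : s * s ≤ c
    s²≤c with ≤∨> s 0#
    ... | inj₁ s≤0 = ≤-trans
      (≤-by (≤-diff s≤0 ⊗ 0≤s) (solve 1 (λ s → (:0 :- s) :* s := :0 :- s :* s) refl s)) 0≤c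
    ... | inj₂ 0<s = ≤-by (≤-diff 2ss≤s²+c)
        (solve 2 (λ s c → s :* s :+ c :- :2 :* s :* s := c :- s :* s) refl s c)
      where
      x : ℝ
      x = (s * s + c) / (2# * s)

      2sx≈s²+c : 2# * s * x ≈ s * s + c
      2sx≈s²+c = *-/-cancel (s * s + c) (0<⇒≉0 (0<2 ⊠ 0<s))

      x-bound : ∀ z → z ∈ S → z ≤ x
      x-bound z (_ , z²≤c) = *-cancelˡ-≤ (0<2 ⊠ 0<s) (≤-respʳ (sym 2sx≈s²+c)
        (≤-by (0≤x² (s - z) ⊕ ≤-diff z²≤c)
          (solve 3 (λ s c z → (s :- z) :* (s :- z) :+ (c :- z :* z) :=
            s :* s :+ c :- :2 :* s :* z) refl s c z)))

      2ss≤s²+c : 2# * s * s ≤ s * s + c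
      2ss≤s²+c = ≤-respʳ 2sx≈s²+c
        (*-monoˡ-≤ (proj₁ (0<2 ⊠ 0<s)) (proj₂ (proj₂ sup) x x-bound))

    c≤s² : c ≤ s * s
    c≤s² = ≮⇒≥ λ s²<c →
      -- The denominator is chosen so that e ≤ 1 and 2se + e² ≤ ke = c - s². Then `s + e` is an
      -- element of `S` above its supremum.
      let k = 2# * s + 1# + c
          0<k = ≤-<-trans (proj₁ 0<2 ⊗ 0≤s) (<-by (0<1 ⊞ 0≤c)
            (solve 2 (λ s c → :1 :+ c := :2 :* s :+ :1 :+ c :- :2 :* s) refl s c))
          e = (c - s * s) / k
          ke≈c-s² = *-/-cancel (c - s * s) (0<⇒≉0 0<k)
          0<e : 0# < e
          0<e = *-cancelˡ-< 0<k (<-by (<-diff s²<c)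
            (trans (sym ke≈c-s²) (solve 2 (λ k e → k :* e := k :* e :- k :* :0) refl k e)))
          e≤1 : e ≤ 1#
          e≤1 = *-cancelˡ-≤ 0<k (≤-respˡ (sym ke≈c-s²)
            (≤-by (proj₁ 0<1 ⊕ proj₁ 0<2 ⊗ 0≤s ⊕ 0≤s ⊗ 0≤s)
              (solve 2 (λ s c → :1 :+ :2 :* s :+ s :* s :=
                (:2 :* s :+ :1 :+ c) :* :1 :- (c :- s :* s)) refl s c)))
          s+e∈S : s + e ∈ S
          s+e∈S = 0≤s ⊕ proj₁ 0<e , ≤-by (proj₁ 0<e ⊗ ≤-diff e≤1 ⊕ 0≤c ⊗ proj₁ 0<e)
            (trans (solve 3 (λ s c e → e :* (:1 :- e) :+ c :* e :=
                (:2 :* s :+ :1 :+ c) :* e :+ s :* s :- (s :+ e) :* (s :+ e)) refl s c e)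
              (+-congʳ (trans (+-congʳ ke≈c-s²)
                (solve 2 (λ s c → c :- s :* s :+ s :* s := c) refl s c))))
      in ≤∧<⇒⊥ (proj₁ (proj₂ sup) (s + e) s+e∈S)
           (<-by 0<e (solve 2 (λ s e → e := s :+ e :- s) refl s e))

  nested-intervals : (l r : ℕ → ℝ) → (∀ n → l n ≤ l (suc n)) →
    (∀ n → r (suc n) ≤ r n) → (∀ n → l n ≤ r n) →
    ∃[ x ] (∀ n → l n ≤ x × x ≤ r n)
  nested-intervals l r l-mono r-anti l≤r = s , λ n →
    s-upper (l n) (n , refl) , s-least (r n) (λ { z (m , z≈lm) → ≤-respˡ (sym z≈lm) (l≤r′ m n) })
    where
    l-mono-+ : ∀ m n → l m ≤ l (n ℕ.+ m)
    l-mono-+ m zero    = ≤-refl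
    l-mono-+ m (suc n) = ≤-trans (l-mono-+ m n) (l-mono (n ℕ.+ m))

    r-anti-+ : ∀ m n → r (m ℕ.+ n) ≤ r n
    r-anti-+ zero    n = ≤-refl
    r-anti-+ (suc m) n = ≤-trans (r-anti (m ℕ.+ n)) (r-anti-+ m n)

    l≤r′ : ∀ m n → l m ≤ r n
    l≤r′ m n = ≤-trans (l-mono-+ m n)
      (≤-trans (≡.subst (λ k → l (n ℕ.+ m) ≤ r k) (ℕₚ.+-comm n m) (l≤r (n ℕ.+ m)))
        (r-anti-+ m n))

    S : Pred ℝ 0ℓ
    S z = ∃[ n ] z ≈ l n

    sup : ∃[ s ] Supremum S s
    sup = complete S (l 0 , 0 , refl)
      (r 0 , λ { z (m , z≈lm) → ≤-respˡ (sym z≈lm) (l≤r′ m 0) })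

    s       = proj₁ sup
    s-upper = proj₁ (proj₂ sup)
    s-least = proj₂ (proj₂ sup)

-- Compact sets on the line: bounds and limit points.

module CompactSets (em : ExcludedMiddle 0ℓ) (R : CompleteOrderedField) where
  open OrderedField em R
  open Fractal R

  <-open : ∀ c → Open (λ x → x < c)
  <-open c x x<c = c - x , <-diff x<c , λ y ∣y-x∣<c-x →
    <-by (<-diff (∣x∣<ε⇒x<ε ∣y-x∣<c-x))
      (solve 3 (λ c x y → c :- x :- (y :- x) := c :- y) refl c x y)

  >-open : ∀ c → Open (λ x → c < x)
  >-open c x c<x = x - c , <-diff c<x , λ y ∣y-x∣<x-c →
    <-by (<-diff (∣x∣<ε⇒-x<ε ∣y-x∣<x-c))
      (solve 3 (λ c x y → x :- c :- (:- (y :- x)) := y :- c) refl c x y)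

  ∪-open : ∀ {U V : Pred ℝ 0ℓ} → Open U → Open V → Open (λ x → x ∈ U ⊎ x ∈ V)
  ∪-open U-open V-open x (inj₁ x∈U) with ε , 0<ε , ball ← U-open x x∈U =
    ε , 0<ε , λ y y∈ball → inj₁ (ball y y∈ball)
  ∪-open U-open V-open x (inj₂ x∈V) with ε , 0<ε , ball ← V-open x x∈V =
    ε , 0<ε , λ y y∈ball → inj₂ (ball y y∈ball)

  -- Joining the indices of a finite subcover gives a single member that covers `E`. Every use of
  -- compactness below takes this form.
  directed-cover : ∀ {E} → Compact E → {I : Set} (U : I → Pred ℝ 0ℓ) →
    (∀ i → Open (U i)) → (∀ x → x ∈ E → ∃[ i ] x ∈ U i) →
    I → (_∨_ : I → I → I) → (∀ i j → U i ⊆ U (i ∨ j)) → (∀ i j → U j ⊆ U (i ∨ j)) →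
    ∃[ i ] (∀ x → x ∈ E → x ∈ U i)
  directed-cover compact {I} U U-open covers i₀ _∨_ left right
    with is , finite ← compact U U-open covers = join is , λ x x∈E → member is (finite x x∈E)
    where
    join : List I → I
    join []       = i₀
    join (i ∷ is) = i ∨ join is

    member : ∀ {x} is → Any (λ i → x ∈ U i) is → x ∈ U (join is)
    member (i ∷ is) (here x∈Ui) = left i (join is) x∈Ui
    member (i ∷ is) (there any) = right i (join is) (member is any)

  x<x+1 : ∀ x → x < x + 1#
  x<x+1 x = <-by 0<1 (solve 1 (λ x → :1 := x :+ :1 :- x) refl x)

  bounded-above : ∀ {E} → Compact E → ∃[ b ] (∀ x → x ∈ E → x < b)
  bounded-above compact = directed-cover compact (λ b x → x < b) <-open
    (λ x _ → x + 1# , x<x+1 x) 0# _⊔_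
    (λ b c x<b → <-≤-trans x<b (x≤x⊔y b c))
    (λ b c x<c → <-≤-trans x<c (x≤y⊔x b c))

  -- Indexing the rays by the negated bound lets `_⊔_` serve as the join here too.
  bounded-below : ∀ {E} → Compact E → ∃[ b ] (∀ x → x ∈ E → - b < x)
  bounded-below compact = directed-cover compact (λ b x → - b < x) (λ b → >-open (- b))
    (λ x _ → - x + 1# , <-by 0<1 (solve 1 (λ x → :1 := x :- :- (:- x :+ :1)) refl x)) 0# _⊔_
    (λ b c -b<x → ≤-<-trans (neg-antitone (x≤x⊔y b c)) -b<x)
    (λ b c -c<x → ≤-<-trans (neg-antitone (x≤y⊔x b c)) -c<x)
    where
    neg-antitone : ∀ {x y} → x ≤ y → - y ≤ - x
    neg-antitone {x} {y} x≤y =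
      ≤-by (≤-diff x≤y) (solve 2 (λ x y → y :- x := :- x :- :- y) refl x y)

  -- Powers of a ratio between 0 and 1.

  module Powers (ƛ : ℝ) (0<ƛ : 0# < ƛ) (ƛ<1 : ƛ < 1#) where
    open import Algebra.Properties.Semiring.Exp semiring public using (_^_)

    ^-pos : ∀ n → 0# < ƛ ^ n
    ^-pos zero    = 0<1
    ^-pos (suc n) = 0<ƛ ⊠ ^-pos n

    ^-antitone : ∀ n → ƛ ^ suc n ≤ ƛ ^ n
    ^-antitone n = ≤-by (≤-diff (proj₁ ƛ<1) ⊗ proj₁ (^-pos n))
      (solve 2 (λ l δ → (:1 :- l) :* δ := δ :- l :* δ) refl ƛ (ƛ ^ n))

    ^-antitone-+ : ∀ m n → ƛ ^ (m ℕ.+ n) ≤ ƛ ^ n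
    ^-antitone-+ zero    n = ≤-refl
    ^-antitone-+ (suc m) n = ≤-trans (^-antitone (m ℕ.+ n)) (^-antitone-+ m n)

    ^-≤1 : ∀ n → ƛ ^ n ≤ 1#
    ^-≤1 zero    = ≤-refl
    ^-≤1 (suc n) = ≤-trans (^-antitone n) (^-≤1 n)

    -- This plays the part of the Archimedean property. The set `S` of all such `x` is closed under
    -- division by `ƛ`, so `ƛ * s` bounds it whenever `s` does; for the supremum this gives s ≤ ƛs,
    -- hence s ≤ 0.
    ≤c*^⇒≤0 : ∀ x c → (∀ n → x ≤ c * ƛ ^ n) → x ≤ 0#
    ≤c*^⇒≤0 x c x∈S = ≮⇒≥ λ 0<x →
      absurd (<-diff ƛ<1 ⊠ <-≤-trans 0<x (s-upper x x∈S) ⊞ ≤-diff (s-least (ƛ * s) ƛs-upper))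
        (solve 2 (λ l s → (:1 :- l) :* s :+ (l :* s :- s) := :0) refl ƛ s)
      where
      S : Pred ℝ 0ℓ
      S z = ∀ n → z ≤ c * ƛ ^ n

      sup : ∃[ s ] Supremum S s
      sup = complete S (x , x∈S) (c * ƛ ^ 0 , λ z z∈S → z∈S 0)

      s       = proj₁ sup
      s-upper = proj₁ (proj₂ sup)
      s-least = proj₂ (proj₂ sup)

      ƛ≉0 = 0<⇒≉0 0<ƛ

      /ƛ-closed : ∀ {z} → z ∈ S → z / ƛ ∈ S
      /ƛ-closed {z} z∈S n = *-cancelˡ-≤ 0<ƛ (≤-respˡ (sym (*-/-cancel z ƛ≉0))
        (≤-respʳ (solve 3 (λ c l δ → c :* (l :* δ) := l :* (c :* δ)) refl c ƛ (ƛ ^ n))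
          (z∈S (suc n))))

      ƛs-upper : UpperBound S (ƛ * s)
      ƛs-upper z z∈S = ≤-respˡ (*-/-cancel z ƛ≉0)
        (*-monoˡ-≤ (proj₁ 0<ƛ) (s-upper (z / ƛ) (/ƛ-closed z∈S)))

    c*^-small : ∀ c {ε} → 0# < ε → ∃[ n ] c * ƛ ^ n < ε
    c*^-small c {ε} 0<ε with em {P = ∃[ n ] c * ƛ ^ n < ε}
    ... | yes small = small
    ... | no ¬small = ⊥-elim (≤∧<⇒⊥ (≤c*^⇒≤0 ε c λ n → ≮⇒≥ λ lt → ¬small (n , lt)) 0<ε)

    -- If `s` were outside `E`, the sets of points farther than ƛⁿ from `s` would be an increasing
    -- open cover of `E`, and one of them would contain all of `E`. But `u n` is within ƛⁿ of `s`.
    limit-closed : ∀ {E} → Compact E → ∀ s (u : ℕ → ℝ) → (∀ n → u n ∈ E) →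
      (∀ n → u n ≤ s + ƛ ^ n) → (∀ n → s ≤ u n + ƛ ^ n) → (∀ {x y} → x ≈ y → x ∈ E → y ∈ E) → s ∈ E
    limit-closed {E} compact s u u∈E u≤ ≤u resp with em {P = s ∈ E}
    ... | yes s∈E = s∈E
    ... | no  s∉E = ⊥-elim (separated (directed-cover compact U
            (λ n → ∪-open (<-open (s - ƛ ^ n)) (>-open (s + ƛ ^ n)))
            cover 0 ℕ._+_ left right))
      where
      U : ℕ → Pred ℝ 0ℓ
      U n x = x < s - ƛ ^ n ⊎ s + ƛ ^ n < x

      shrink : ∀ m n → ƛ ^ n ≤ ƛ ^ m → U m ⊆ U n
      shrink m n n≤m {x} (inj₁ x<) = inj₁ (<-≤-trans x< (≤-by (≤-diff n≤m)
        (solve 3 (λ s a b → b :- a := s :- a :- (s :- b)) refl s (ƛ ^ n) (ƛ ^ m))))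
      shrink m n n≤m {x} (inj₂ <x) = inj₂ (≤-<-trans (≤-by (≤-diff n≤m)
        (solve 3 (λ s a b → b :- a := s :+ b :- (s :+ a)) refl s (ƛ ^ n) (ƛ ^ m))) <x)

      left : ∀ m n → U m ⊆ U (m ℕ.+ n)
      left m n = shrink m (m ℕ.+ n) (≡.subst (λ k → ƛ ^ k ≤ ƛ ^ m) (ℕₚ.+-comm n m) (^-antitone-+ n m))

      right : ∀ m n → U n ⊆ U (m ℕ.+ n)
      right m n = shrink n (m ℕ.+ n) (^-antitone-+ m n)

      cover : ∀ x → x ∈ E → ∃[ n ] x ∈ U n
      cover x x∈E with ≤∨> x s | ≤∨> s x
      ... | inj₁ x≤s | inj₁ s≤x = ⊥-elim (s∉E (resp (antisym x≤s s≤x) x∈E))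
      ... | inj₂ s<x | _ with n , lt ← c*^-small 1# (<-diff s<x) =
        n , inj₂ (<-by (<-diff lt)
          (solve 3 (λ s x δ → x :- s :- :1 :* δ := x :- (s :+ δ)) refl s x (ƛ ^ n)))
      ... | inj₁ _ | inj₂ x<s with n , lt ← c*^-small 1# (<-diff x<s) =
        n , inj₁ (<-by (<-diff lt)
          (solve 3 (λ s x δ → s :- x :- :1 :* δ := s :- δ :- x) refl s x (ƛ ^ n)))

      separated : ¬ (∃[ n ] (∀ x → x ∈ E → x ∈ U n))
      separated (n , E⊆U) with E⊆U (u n) (u∈E n)
      ... | inj₁ u< = ≤∧<⇒⊥ (≤u n) (<-by (<-diff u<)
        (solve 3 (λ s x δ → s :- δ :- x := s :- (x :+ δ)) refl s (u n) (ƛ ^ n)))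
      ... | inj₂ <u = ≤∧<⇒⊥ (u≤ n) <u

  -- The Cantor set: extreme points and self-similar structure.

  module CantorSet (ƛ : ℝ) (0<ƛ : 0# < ƛ) (ƛ<½ : ƛ < 1# / 2#)
    (F : Pred ℝ 0ℓ) (isCantorSet : IsCantorSet ƛ F) where

    0<1-2ƛ : 0# < 1# - 2# * ƛ
    0<1-2ƛ = ≤-respʳ e≈ (proj₁ 0<e) , λ 0≈ → proj₂ 0<e (trans 0≈ (sym e≈))
      where
      0<e = 0<2 ⊠ <-diff ƛ<½
      e≈ : 2# * (1# / 2# - ƛ) ≈ 1# - 2# * ƛ
      e≈ = trans (solve 2 (λ h l → :2 :* (h :- l) := :2 :* h :- :2 :* l) refl (1# / 2#) ƛ)
        (+-congʳ (*-/-cancel 1# (0<⇒≉0 0<2)))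

    0<1-ƛ : 0# < 1# - ƛ
    0<1-ƛ = ≤-<-trans (proj₁ 0<1-2ƛ) (<-by 0<ƛ
      (solve 1 (λ l → l := :1 :- l :- (:1 :- :2 :* l)) refl ƛ))

    ƛ<1 : ƛ < 1#
    ƛ<1 = <-by 0<1-ƛ refl

    open Powers ƛ 0<ƛ ƛ<1 public

    compact : Compact F
    compact = proj₁ (proj₂ isCantorSet)

    F-resp : ∀ {x y} → x ≈ y → x ∈ F → y ∈ F
    F-resp x≈y x∈F with i , z , z∈F , x≈fz ← proj₁ (proj₂ (proj₂ isCantorSet)) x∈F =
      proj₂ (proj₂ (proj₂ isCantorSet)) (i , z , z∈F , trans (sym x≈y) x≈fz)

    F-left : ∀ {x} → x ∈ F → ƛ * x ∈ F
    F-left {x} x∈F = proj₂ (proj₂ (proj₂ isCantorSet)) (Fin.zero , x , x∈F , refl)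

    F-right : ∀ {x} → x ∈ F → ƛ * x + (1# - ƛ) ∈ F
    F-right {x} x∈F = proj₂ (proj₂ (proj₂ isCantorSet)) (Fin.suc Fin.zero , x , x∈F , refl)

    F-split : ∀ {y} → y ∈ F → ∃[ x ] (x ∈ F × (y ≈ ƛ * x ⊎ y ≈ ƛ * x + (1# - ƛ)))
    F-split y∈F with proj₁ (proj₂ (proj₂ isCantorSet)) y∈F
    ... | Fin.zero         , x , x∈F , y≈ = x , x∈F , inj₁ y≈
    ... | Fin.suc Fin.zero , x , x∈F , y≈ = x , x∈F , inj₂ y≈

    -- Any bound improves itself: the excess of a point over 1 is at most `ƛ` times that of its
    -- preimage under the right map, and the left map yields even less. After n generations the
    -- excess is at most bƛⁿ.
    upper-bound⇒≤1 : ∀ b → (∀ x → x ∈ F → x < b) → ∀ x → x ∈ F → x ≤ 1#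
    upper-bound⇒≤1 b F<b x x∈F = ≤-by (≤-diff (≤c*^⇒≤0 (x - 1#) b λ n → claim n x∈F))
        (solve 1 (λ x → :0 :- (x :- :1) := :1 :- x) refl x)
      where
      claim : ∀ n {x} → x ∈ F → x - 1# ≤ b * ƛ ^ n
      claim zero {x} x∈F = ≤-by (proj₁ (<-diff (F<b x x∈F)) ⊕ proj₁ 0<1)
        (solve 2 (λ b x → b :- x :+ :1 := b :* :1 :- (x :- :1)) refl b x)
      claim (suc n) {x} x∈F with F-split x∈F
      ... | z , z∈F , inj₁ x≈ = ≤-respˡ (+-congʳ (sym x≈))
        (≤-by (proj₁ 0<ƛ ⊗ ≤-diff (claim n z∈F) ⊕ proj₁ 0<1-ƛ)
          (solve 4 (λ l b d z → l :* (b :* d :- (z :- :1)) :+ (:1 :- l) :=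
            b :* (l :* d) :- (l :* z :- :1)) refl ƛ b (ƛ ^ n) z))
      ... | z , z∈F , inj₂ x≈ = ≤-respˡ (+-congʳ (sym x≈))
        (≤-by (proj₁ 0<ƛ ⊗ ≤-diff (claim n z∈F))
          (solve 4 (λ l b d z → l :* (b :* d :- (z :- :1)) :=
            b :* (l :* d) :- (l :* z :+ (:1 :- l) :- :1)) refl ƛ b (ƛ ^ n) z))

    lower-bound⇒0≤ : ∀ b → (∀ x → x ∈ F → - b < x) → ∀ x → x ∈ F → 0# ≤ x
    lower-bound⇒0≤ b -b<F x x∈F = ≤-by (≤-diff (≤c*^⇒≤0 (- x) b λ n → claim n x∈F))
        (solve 1 (λ x → :0 :- :- x := x :- :0) refl x)
      where
      claim : ∀ n {x} → x ∈ F → - x ≤ b * ƛ ^ n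
      claim zero {x} x∈F = ≤-by (proj₁ (<-diff (-b<F x x∈F)))
        (solve 2 (λ b x → x :- :- b := b :* :1 :- :- x) refl b x)
      claim (suc n) {x} x∈F with F-split x∈F
      ... | z , z∈F , inj₁ x≈ = ≤-respˡ (-‿cong (sym x≈))
        (≤-by (proj₁ 0<ƛ ⊗ ≤-diff (claim n z∈F))
          (solve 4 (λ l b d z → l :* (b :* d :- :- z) :=
            b :* (l :* d) :- :- (l :* z)) refl ƛ b (ƛ ^ n) z))
      ... | z , z∈F , inj₂ x≈ = ≤-respˡ (-‿cong (sym x≈))
        (≤-by (proj₁ 0<ƛ ⊗ ≤-diff (claim n z∈F) ⊕ proj₁ 0<1-ƛ)
          (solve 4 (λ l b d z → l :* (b :* d :- :- z) :+ (:1 :- l) :=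
            b :* (l :* d) :- :- (l :* z :+ (:1 :- l))) refl ƛ b (ƛ ^ n) z))

    F≤1 : ∀ x → x ∈ F → x ≤ 1#
    F≤1 = upper-bound⇒≤1 _ (proj₂ (bounded-above compact))

    0≤F : ∀ x → x ∈ F → 0# ≤ x
    0≤F = lower-bound⇒0≤ _ (proj₂ (bounded-below compact))

    F-limit : ∀ s (u : ℕ → ℝ) → (∀ n → u n ∈ F) →
      (∀ n → u n ≤ s + ƛ ^ n) → (∀ n → s ≤ u n + ƛ ^ n) → s ∈ F
    F-limit s u u∈F u≤ ≤u = limit-closed compact s u u∈F u≤ ≤u F-resp

    -- 0 is the fixed point of the left map, and the orbit of any point of `F` approaches it at rate
    -- ƛⁿ. The same argument with the right map gives 1.
    0∈F : 0# ∈ F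
    0∈F with x , x∈F ← proj₁ isCantorSet = F-limit 0# (λ n → ƛ ^ n * x) u∈F
        (λ n → ≤-by (proj₁ (^-pos n) ⊗ ≤-diff (F≤1 x x∈F))
          (solve 2 (λ d x → d :* (:1 :- x) := :0 :+ d :- d :* x) refl (ƛ ^ n) x))
        (λ n → proj₁ (^-pos n) ⊗ 0≤F x x∈F ⊕ proj₁ (^-pos n))
      where
      u∈F : ∀ n → ƛ ^ n * x ∈ F
      u∈F zero    = F-resp (solve 1 (λ x → x := :1 :* x) refl x) x∈F
      u∈F (suc n) = F-resp (solve 3 (λ l d x → l :* (d :* x) := l :* d :* x) refl ƛ (ƛ ^ n) x)
        (F-left (u∈F n))

    1∈F : 1# ∈ F
    1∈F with x , x∈F ← proj₁ isCantorSet = F-limit 1# (λ n → 1# - ƛ ^ n * (1# - x)) u∈F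
        (λ n → ≤-by (proj₁ (^-pos n) ⊗ ≤-diff (F≤1 x x∈F) ⊕ proj₁ (^-pos n))
          (solve 2 (λ d x → d :* (:1 :- x) :+ d := :1 :+ d :- (:1 :- d :* (:1 :- x))) refl (ƛ ^ n) x))
        (λ n → ≤-by (proj₁ (^-pos n) ⊗ 0≤F x x∈F)
          (solve 2 (λ d x → d :* x := :1 :- d :* (:1 :- x) :+ d :- :1) refl (ƛ ^ n) x))
      where
      u∈F : ∀ n → 1# - ƛ ^ n * (1# - x) ∈ F
      u∈F zero    = F-resp (solve 1 (λ x → x := :1 :- :1 :* (:1 :- x)) refl x) x∈F
      u∈F (suc n) = F-resp
        (solve 3 (λ l d x → l :* (:1 :- d :* (:1 :- x)) :+ (:1 :- l) :=
          :1 :- l :* d :* (:1 :- x)) refl ƛ (ƛ ^ n) x)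
        (F-right (u∈F n))

    ƛ∈F : ƛ ∈ F
    ƛ∈F = F-resp (solve 1 (λ l → l :* :1 := l) refl ƛ) (F-left 1∈F)

    1-ƛ∈F : 1# - ƛ ∈ F
    1-ƛ∈F = F-resp (solve 1 (λ l → l :* :0 :+ (:1 :- l) := :1 :- l) refl ƛ) (F-right 0∈F)

    -- The set D

    -- In the following two lemmas [p , p + δ] and [q , q + δ] are basic intervals
    -- of F, and t is a potential value of x² / y on their product.

    no-bridge-in-gap : 1# - 2# * ƛ ≤ 2# * ƛ * (1# - ƛ) → ∀ {t u q δ} →
      0# ≤ t → 0# < δ → 0# ≤ u → u ≤ 1# → 1# - ƛ ≤ q →
      t * (q + ƛ * δ) < u * u →
      (u + ƛ * δ) * (u + ƛ * δ) < t * (q + (1# - ƛ) * δ) → ⊥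
    no-bridge-in-gap wide {t} {u} {q} {δ} 0≤t 0<δ 0≤u u≤1 1-ƛ≤q lower upper =
      -- The interval [u² , (u + ƛδ)²] would lie in a gap of length t(1 - 2ƛ)δ, but it is at least
      -- 2uƛδ long. From tq < u² ≤ u, 1 - ƛ ≤ q and `wide`, the gap is too short.
      absurd (0<q ⊠ (<-diff lower ⊞ proj₁ (<-diff upper)) ⊞
          proj₁ 0<δ ⊗ (0≤1-2ƛ ⊗ proj₁ (<-diff lower) ⊕
            0≤u ⊗ (proj₁ 0<2 ⊗ 0≤ƛ ⊗ ≤-diff 1-ƛ≤q ⊕ ≤-diff wide ⊕ 0≤1-2ƛ ⊗ ≤-diff u≤1) ⊕
            0≤1-2ƛ ⊗ 0≤t ⊗ 0≤ƛ ⊗ proj₁ 0<δ ⊕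
            0≤ƛ ⊗ 0≤ƛ ⊗ proj₁ 0<q ⊗ proj₁ 0<δ))
        (solve 5 (λ l t u q d →
          q :* (u :* u :- t :* (q :+ l :* d) :+
                (t :* (q :+ (:1 :- l) :* d) :- (u :+ l :* d) :* (u :+ l :* d))) :+
          d :* ((:1 :- :2 :* l) :* (u :* u :- t :* (q :+ l :* d)) :+
            u :* (:2 :* l :* (q :- (:1 :- l)) :+ (:2 :* l :* (:1 :- l) :- (:1 :- :2 :* l)) :+
                  (:1 :- :2 :* l) :* (:1 :- u)) :+
            (:1 :- :2 :* l) :* t :* l :* d :+ l :* l :* q :* d) := :0)
          refl ƛ t u q δ)
      where
      0≤ƛ     = proj₁ 0<ƛ
      0≤1-2ƛ  = proj₁ 0<1-2ƛ
      0<q     = <-≤-trans 0<1-ƛ 1-ƛ≤q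

    -- The interval t[q , q + δ] has length tδ, while the gap between the squares has length (1 -
    -- 2ƛ)δ(2p + δ) ≤ 2(1 - 2ƛ)δ. This settles the case of large `t`.
    not-inside-gap : ∀ {t p q δ} → (2# * (1# - 2# * ƛ) ≤ t ⊎ 1# ≤ 3# * ƛ) →
      0# ≤ t → 0# < δ → 1# - ƛ ≤ p → p + δ ≤ 1# → 0# ≤ q → q + δ ≤ 1# →
      (p + ƛ * δ) * (p + ƛ * δ) < t * q →
      t * (q + δ) < (p + (1# - ƛ) * δ) * (p + (1# - ƛ) * δ) → ⊥
    not-inside-gap {t} {p} {q} {δ} (inj₁ large) 0≤t 0<δ 1-ƛ≤p p+δ≤1 0≤q q+δ≤1 lower upper =
      absurd (<-diff lower ⊞ proj₁ (<-diff upper) ⊞ (proj₁ 0<δ ⊗ ≤-diff large) ⊞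
          (proj₁ 0<δ ⊗ proj₁ 0<1-2ƛ ⊗ (proj₁ 0<2 ⊗ ≤-diff p+δ≤1 ⊕ proj₁ 0<δ)))
        (solve 5 (λ l t p q d →
          t :* q :- (p :+ l :* d) :* (p :+ l :* d) :+
          ((p :+ (:1 :- l) :* d) :* (p :+ (:1 :- l) :* d) :- t :* (q :+ d)) :+
          d :* (t :- :2 :* (:1 :- :2 :* l)) :+
          d :* (:1 :- :2 :* l) :* (:2 :* (:1 :- (p :+ d)) :+ d) := :0)
          refl ƛ t p q δ)
    -- Here 3ƛ ≥ 1 gives p ≥ 1 - ƛ ≥ 2(1 - 2ƛ). So t(1 - δ) ≥ tq > p² ≥ 2p(1 - 2ƛ) ≥ (1 - δ)(1 -
    -- 2ƛ)(2p + δ), and again tδ exceeds the length of the gap.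
    not-inside-gap {t} {p} {q} {δ} (inj₂ 1≤3ƛ) 0≤t 0<δ 1-ƛ≤p p+δ≤1 0≤q q+δ≤1 lower upper =
      absurd (0<δ ⊠ <-diff lower ⊞
          (≤-diff q+δ≤1 ⊕ 0≤q) ⊗ (proj₁ (<-diff lower) ⊕ proj₁ (<-diff upper)) ⊞
          proj₁ 0<δ ⊗ (0≤t ⊗ ≤-diff q+δ≤1 ⊕
            (0≤p ⊗ (≤-diff 1-ƛ≤p ⊕ ≤-diff 1≤3ƛ) ⊕
             proj₁ 0<2 ⊗ 0≤p ⊗ 0≤ƛ ⊗ proj₁ 0<δ ⊕ 0≤ƛ ⊗ 0≤ƛ ⊗ proj₁ 0<δ ⊗ proj₁ 0<δ ⊕
             proj₁ 0<1-2ƛ ⊗ proj₁ 0<δ ⊗ (proj₁ 0<δ ⊕ proj₁ 0<2 ⊗ ≤-diff 1-ƛ≤p ⊕ proj₁ 0<1-2ƛ))))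
        (solve 5 (λ l t p q d →
          d :* (t :* q :- (p :+ l :* d) :* (p :+ l :* d)) :+
          (:1 :- (q :+ d) :+ q) :*
            (t :* q :- (p :+ l :* d) :* (p :+ l :* d) :+
             ((p :+ (:1 :- l) :* d) :* (p :+ (:1 :- l) :* d) :- t :* (q :+ d))) :+
          d :* (t :* (:1 :- (q :+ d)) :+
            (p :* (p :- (:1 :- l) :+ (:3 :* l :- :1)) :+
             :2 :* p :* l :* d :+ l :* l :* d :* d :+
             (:1 :- :2 :* l) :* d :* (d :+ :2 :* (p :- (:1 :- l)) :+ (:1 :- :2 :* l)))) := :0)
          refl ƛ t p q δ)
      where
      0≤ƛ = proj₁ 0<ƛ
      0≤p = ≤-trans (proj₁ 0<1-ƛ) 1-ƛ≤p

    -- A basic interval [p , p + δ] inside [1 - ƛ , 1]. Its place in the construction is recorded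
    -- only through `copy`: it carries a scaled copy of `F`.
    record Corner (δ p : ℝ) : Set where
      field
        1-ƛ≤p : 1# - ƛ ≤ p
        p+δ≤1 : p + δ ≤ 1#
        copy  : ∀ {x} → x ∈ F → p + δ * x ∈ F

    record Child (δ p p′ : ℝ) : Set where
      field
        corner : Corner (ƛ * δ) p′
        p≤p′   : p ≤ p′
        nested : p′ + ƛ * δ ≤ p + δ

    right : ℝ → ℝ → ℝ
    right δ p = p + (1# - ƛ) * δ

    right-end : ∀ δ p → right δ p + ƛ * δ ≈ p + δ
    right-end δ p = solve 3 (λ l d p → p :+ (:1 :- l) :* d :+ l :* d := p :+ d) refl ƛ δ p

    left-child : ∀ {δ p} → 0# < δ → Corner δ p → Child δ p p
    left-child {δ} {p} 0<δ c = record
      { corner = record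
        { 1-ƛ≤p = 1-ƛ≤p
        ; p+δ≤1 = ≤-trans p+ƛδ≤p+δ p+δ≤1
        ; copy  = λ {x} x∈F → F-resp
            (solve 4 (λ l d p x → p :+ d :* (l :* x) := p :+ l :* d :* x) refl ƛ δ p x)
            (copy (F-left x∈F))
        }
      ; p≤p′   = ≤-refl
      ; nested = p+ƛδ≤p+δ
      }
      where
      open Corner c
      p+ƛδ≤p+δ : p + ƛ * δ ≤ p + δ
      p+ƛδ≤p+δ = ≤-by (proj₁ (0<1-ƛ ⊠ 0<δ))
        (solve 3 (λ l d p → (:1 :- l) :* d := p :+ d :- (p :+ l :* d)) refl ƛ δ p)

    right-child : ∀ {δ p} → 0# < δ → Corner δ p → Child δ p (right δ p)
    right-child {δ} {p} 0<δ c = record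
      { corner = record
        { 1-ƛ≤p = ≤-trans 1-ƛ≤p p≤right
        ; p+δ≤1 = ≤-respˡ (sym (right-end δ p)) p+δ≤1
        ; copy  = λ {x} x∈F → F-resp
            (solve 4 (λ l d p x → p :+ d :* (l :* x :+ (:1 :- l)) :=
              p :+ (:1 :- l) :* d :+ l :* d :* x) refl ƛ δ p x)
            (copy (F-right x∈F))
        }
      ; p≤p′   = p≤right
      ; nested = ≤-reflexive (right-end δ p)
      }
      where
      open Corner c
      p≤right : p ≤ right δ p
      p≤right = ≤-by (proj₁ (0<1-ƛ ⊠ 0<δ))
        (solve 3 (λ l d p → (:1 :- l) :* d := p :+ (:1 :- l) :* d :- p) refl ƛ δ p)

    -- The curve x² = t y passes weakly below the upper left and weakly above the
    -- lower right corner of the square [p , p + δ] × [q , q + δ].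
    record Square (t δ : ℝ) : Set where
      field
        p q     : ℝ
        pCorner : Corner δ p
        qCorner : Corner δ q
        lower   : p * p ≤ t * (q + δ)
        upper   : t * q ≤ (p + δ) * (p + δ)

    record Refinement {t δ} (S : Square t δ) : Set where
      open Square S
      field
        square : Square t (ƛ * δ)
        pChild : Child δ p (Square.p square)
        qChild : Child δ q (Square.q square)

    square-cong : ∀ {x y} → x ≈ y → x * x ≈ y * y
    square-cong x≈y = *-cong x≈y x≈y

    module _ (wide : 1# - 2# * ƛ ≤ 2# * ƛ * (1# - ƛ)) (t : ℝ) (0≤t : 0# ≤ t)
      (no-gap : 2# * (1# - 2# * ƛ) ≤ t ⊎ 1# ≤ 3# * ƛ) where

      -- The inequalities of a `Square` say that [p² , (p + δ)²] and t[q , q + δ] overlap. If no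
      -- pair of children overlapped, either a child of the first interval would lie in the gap of
      -- the second, against `no-bridge-in-gap`, or the whole second interval would lie in the gap
      -- of the first, against `not-inside-gap`.
      refine : ∀ {δ} → 0# < δ → (S : Square t δ) → Refinement S
      refine {δ} 0<δ S = choose
        where
        open Square S
        open Corner pCorner using () renaming (1-ƛ≤p to 1-ƛ≤p; p+δ≤1 to p+δ≤1)
        open Corner qCorner using () renaming (1-ƛ≤p to 1-ƛ≤q; p+δ≤1 to q+δ≤1)

        p₂ = right δ p
        q₂ = right δ q

        0≤1-ƛ = proj₁ 0<1-ƛ

        child : ∀ {p′ q′} → Child δ p p′ → Child δ q q′ →
          p′ * p′ ≤ t * (q′ + ƛ * δ) → t * q′ ≤ (p′ + ƛ * δ) * (p′ + ƛ * δ) → Refinement S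
        child {p′} {q′} pc qc lower′ upper′ = record
          { square = record
            { p       = p′
            ; q       = q′
            ; pCorner = Child.corner pc
            ; qCorner = Child.corner qc
            ; lower   = lower′
            ; upper   = upper′
            }
          ; pChild = pc
          ; qChild = qc
          }

        p-left  = left-child 0<δ pCorner
        p-right = right-child 0<δ pCorner
        q-left  = left-child 0<δ qCorner
        q-right = right-child 0<δ qCorner

        toQEnd : t * (q + δ) ≈ t * (q₂ + ƛ * δ)
        toQEnd = *-congˡ (sym (right-end δ q))

        toPEnd : (p + δ) * (p + δ) ≈ (p₂ + ƛ * δ) * (p₂ + ƛ * δ)
        toPEnd = square-cong (sym (right-end δ p))

        0≤p : 0# ≤ p
        0≤p = ≤-trans 0≤1-ƛ 1-ƛ≤p

        p≤1 : p ≤ 1#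
        p≤1 = ≤-trans (≤-by (proj₁ 0<δ) (solve 2 (λ p d → d := p :+ d :- p) refl p δ)) p+δ≤1

        p₂≤1 : p₂ ≤ 1#
        p₂≤1 = ≤-trans (≤-by (proj₁ 0<ƛ ⊗ proj₁ 0<δ)
          (solve 3 (λ l p d → l :* d := p :+ d :- (p :+ (:1 :- l) :* d)) refl ƛ p δ)) p+δ≤1

        choose : Refinement S
        choose with ≤∨> (t * q) ((p + ƛ * δ) * (p + ƛ * δ))
        choose | inj₂ p₁<q with ≤∨> (p₂ * p₂) (t * (q + ƛ * δ))
        ... | inj₁ p₂≤q₁ = child p-right q-left p₂≤q₁ (≤-respʳ toPEnd upper)
        ... | inj₂ q₁<p₂ with ≤∨> (p₂ * p₂) (t * (q + δ)) | ≤∨> (t * q₂) ((p₂ + ƛ * δ) * (p₂ + ƛ * δ))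
        ... | inj₂ q<p₂ | _         = ⊥-elim (not-inside-gap no-gap 0≤t 0<δ 1-ƛ≤p p+δ≤1
                                        (≤-trans 0≤1-ƛ 1-ƛ≤q) q+δ≤1 p₁<q q<p₂)
        ... | inj₁ p₂≤q | inj₁ q₂≤p = child p-right q-right (≤-respʳ toQEnd p₂≤q) q₂≤p
        ... | inj₁ _    | inj₂ p<q₂ = ⊥-elim (no-bridge-in-gap wide 0≤t 0<δ
                                        (≤-trans 0≤p (Child.p≤p′ p-right)) p₂≤1 1-ƛ≤q q₁<p₂ p<q₂)
        choose | inj₁ q≤p₁ with ≤∨> (p * p) (t * (q + ƛ * δ))
        ... | inj₁ p≤q₁ = child p-left q-left p≤q₁ q≤p₁
        ... | inj₂ q₁<p with ≤∨> (t * q₂) ((p + ƛ * δ) * (p + ƛ * δ))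
        ... | inj₁ q₂≤p₁ = child p-left q-right (≤-respʳ toQEnd lower) q₂≤p₁
        ... | inj₂ p₁<q₂ = ⊥-elim (no-bridge-in-gap wide 0≤t 0<δ 0≤p p≤1 1-ƛ≤q q₁<p p₁<q₂)

    -- Over the square, x² ranges over an interval of length δ(2p + δ) ≤ 2δ and ty over one of
    -- length tδ, and these two intervals overlap.
    square-near-curve : ∀ {t δ x y} → 0# ≤ t → 0# ≤ δ → (S : Square t δ) (let open Square S) →
      p ≤ x → x ≤ p + δ → q ≤ y → y ≤ q + δ →
      x * x - t * y ≤ (t + 2#) * δ × t * y - x * x ≤ (t + 2#) * δ
    square-near-curve {t} {δ} {x} {y} 0≤t 0≤δ S p≤x x≤p+δ q≤y y≤q+δ =
      ≤-by (≤-diff x≤p+δ ⊗ (0≤p ⊕ 0≤δ ⊕ 0≤x) ⊕ ≤-diff lower ⊕ 0≤t ⊗ ≤-diff q≤y ⊕ 0≤slope)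
        (solve 6 (λ t d x y p q →
          (p :+ d :- x) :* (p :+ d :+ x) :+ (t :* (q :+ d) :- p :* p) :+ t :* (y :- q) :+
          d :* (:2 :* (:1 :- (p :+ d)) :+ d) :=
          (t :+ :2) :* d :- (x :* x :- t :* y)) refl t δ x y p q) ,
      ≤-by (≤-diff p≤x ⊗ (0≤x ⊕ 0≤p) ⊕ ≤-diff upper ⊕ 0≤t ⊗ ≤-diff y≤q+δ ⊕ 0≤slope)
        (solve 6 (λ t d x y p q →
          (x :- p) :* (x :+ p) :+ ((p :+ d) :* (p :+ d) :- t :* q) :+ t :* (q :+ d :- y) :+
          d :* (:2 :* (:1 :- (p :+ d)) :+ d) :=
          (t :+ :2) :* d :- (t :* y :- x :* x)) refl t δ x y p q)
      where
      open Square S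
      0≤p     = ≤-trans (proj₁ 0<1-ƛ) (Corner.1-ƛ≤p pCorner)
      0≤x     = ≤-trans 0≤p p≤x
      0≤slope = 0≤δ ⊗ (proj₁ 0<2 ⊗ ≤-diff (Corner.p+δ≤1 pCorner) ⊕ 0≤δ)

    D-intro : ∀ {x y t} → x ∈ F → y ∈ F → 0# < y → x * x ≈ t * y → t ∈ D F
    D-intro {x} {y} {t} x∈F y∈F 0<y x²≈ty = x , y , x∈F , y∈F , 0<⇒≉0 0<y , (begin
      t                ≈⟨ solve 1 (λ t → t := t :* :1) refl t ⟩
      t * 1#           ≈⟨ *-congˡ (⁻¹-inverseʳ (0<⇒≉0 0<y)) ⟨
      t * (y * y ⁻¹)   ≈⟨ solve 3 (λ t y z → t :* (y :* z) := t :* y :* z) refl t y (y ⁻¹) ⟩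
      t * y * y ⁻¹     ≈⟨ *-congʳ x²≈ty ⟨
      x * x / y        ∎)
      where open import Relation.Binary.Reasoning.Setoid setoid

    D-elim : ∀ {t} → t ∈ D F → ∃[ x ] ∃[ y ] (x ∈ F × y ∈ F × 0# < y × x * x ≈ t * y)
    D-elim (x , y , x∈F , y∈F , y≉0 , t≈) =
      x , y , x∈F , y∈F , (0≤F y y∈F , λ 0≈y → y≉0 (sym 0≈y)) ,
      trans (sym (*-/-cancel (x * x) y≉0)) (trans (*-congˡ (sym t≈)) (*-comm y _))

    square⇒∈D : 1# - 2# * ƛ ≤ 2# * ƛ * (1# - ƛ) → ∀ t → 0# ≤ t →
      2# * (1# - 2# * ƛ) ≤ t ⊎ 1# ≤ 3# * ƛ → Square t (ƛ ^ 1) → t ∈ D F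
    square⇒∈D wide t 0≤t no-gap S₀ =
      D-intro (corner-limit x p pCornerₙ x-in) y∈F (<-≤-trans 0<1-ƛ
        (≤-trans (Corner.1-ƛ≤p (qCornerₙ 0)) (proj₁ (y-in 0)))) x²≈ty
      where
      -- The exponent is shifted because the initial square is [1 - ƛ , 1]², of side `ƛ`.
      δ : ℕ → ℝ
      δ n = ƛ ^ suc n

      step : ∀ n (S : Square t (δ n)) → Refinement S
      step n = refine wide t 0≤t no-gap (^-pos (suc n))

      S : ∀ n → Square t (δ n)
      S zero    = S₀
      S (suc n) = Refinement.square (step n (S n))

      p q : ℕ → ℝ
      p n = Square.p (S n)
      q n = Square.q (S n)

      pCornerₙ : ∀ n → Corner (δ n) (p n)
      pCornerₙ n = Square.pCorner (S n)

      qCornerₙ : ∀ n → Corner (δ n) (q n)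
      qCornerₙ n = Square.qCorner (S n)

      nested : (p : ℕ → ℝ) → (∀ n → Child (δ n) (p n) (p (suc n))) →
        ∃[ x ] (∀ n → p n ≤ x × x ≤ p n + δ n)
      nested p child = nested-intervals p (λ n → p n + δ n) (λ n → Child.p≤p′ (child n))
        (λ n → Child.nested (child n))
        (λ n → ≤-by (proj₁ (^-pos (suc n))) (solve 2 (λ p d → d := p :+ d :- p) refl (p n) (δ n)))

      corner-limit : ∀ x (p : ℕ → ℝ) → (∀ n → Corner (δ n) (p n)) →
        (∀ n → p n ≤ x × x ≤ p n + δ n) → x ∈ F
      corner-limit x p corners x-in = F-limit x p
        (λ n → F-resp (solve 2 (λ p d → p :+ d :* :0 := p) refl (p n) (δ n))
          (Corner.copy (corners n) 0∈F))
        (λ n → ≤-trans (proj₁ (x-in n)) (≤-by (proj₁ (^-pos n))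
          (solve 2 (λ x d → d := x :+ d :- x) refl x (ƛ ^ n))))
        (λ n → ≤-trans (proj₂ (x-in n)) (≤-by (≤-diff (^-antitone n))
          (solve 3 (λ p d e → e :- d := p :+ e :- (p :+ d)) refl (p n) (δ n) (ƛ ^ n))))

      x-lim = nested p (λ n → Refinement.pChild (step n (S n)))
      y-lim = nested q (λ n → Refinement.qChild (step n (S n)))
      x     = proj₁ x-lim
      y     = proj₁ y-lim
      x-in  = proj₂ x-lim
      y-in  = proj₂ y-lim

      y∈F : y ∈ F
      y∈F = corner-limit y q qCornerₙ y-in

      x²≈ty : x * x ≈ t * y
      x²≈ty = antisym (difference≤0 (λ n → proj₁ (near n))) (difference≤0 (λ n → proj₂ (near n)))
        where
        near : ∀ n → x * x - t * y ≤ (t + 2#) * δ n × t * y - x * x ≤ (t + 2#) * δ n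
        near n = square-near-curve 0≤t (proj₁ (^-pos (suc n))) (S n)
          (proj₁ (x-in n)) (proj₂ (x-in n)) (proj₁ (y-in n)) (proj₂ (y-in n))

        difference≤0 : ∀ {a b} → (∀ n → a - b ≤ (t + 2#) * δ n) → a ≤ b
        difference≤0 {a} {b} a-b≤ = ≤-by
          (≤-diff (≤c*^⇒≤0 (a - b) ((t + 2#) * ƛ) λ n → ≤-respʳ
            (solve 3 (λ t l d → (t :+ :2) :* (l :* d) := (t :+ :2) :* l :* d) refl t ƛ (ƛ ^ n))
            (a-b≤ n)))
          (solve 2 (λ a b → :0 :- (a :- b) := b :- a) refl a b)

    initial-square : ∀ {t} → (1# - ƛ) * (1# - ƛ) ≤ t → t * (1# - ƛ) ≤ 1# → Square t (ƛ ^ 1)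
    initial-square {t} t-lower t-upper = record
      { p       = 1# - ƛ
      ; q       = 1# - ƛ
      ; pCorner = corner
      ; qCorner = corner
      ; lower   = ≤-respʳ (solve 2 (λ l t → t := t :* (:1 :- l :+ l :* :1)) refl ƛ t) t-lower
      ; upper   = ≤-respʳ (solve 1 (λ l → :1 := (:1 :- l :+ l :* :1) :* (:1 :- l :+ l :* :1)) refl ƛ)
                    t-upper
      }
      where
      corner : Corner (ƛ ^ 1) (1# - ƛ)
      corner = record
        { 1-ƛ≤p = ≤-refl
        ; p+δ≤1 = ≤-reflexive (solve 1 (λ l → :1 :- l :+ l :* :1 := :1) refl ƛ)
        ; copy  = λ {x} x∈F → F-resp
            (solve 2 (λ l x → l :* x :+ (:1 :- l) := :1 :- l :+ l :* :1 :* x) refl ƛ x) (F-right x∈F)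
        }

    ratio∈D : 1# - 2# * ƛ ≤ 2# * ƛ * (1# - ƛ) → ∀ t →
      2# * (1# - 2# * ƛ) ≤ t ⊎ 1# ≤ 3# * ƛ →
      (1# - ƛ) * (1# - ƛ) ≤ t → t * (1# - ƛ) ≤ 1# → t ∈ D F
    ratio∈D wide t no-gap t-lower t-upper =
      square⇒∈D wide t (≤-trans (0≤x² (1# - ƛ)) t-lower) no-gap (initial-square t-lower t-upper)

    D-resp : ∀ {s t} → s ≈ t → s ∈ D F → t ∈ D F
    D-resp s≈t (x , y , x∈F , y∈F , y≉0 , s≈) = x , y , x∈F , y∈F , y≉0 , trans (sym s≈t) s≈

    0≤D : ∀ {t} → t ∈ D F → 0# ≤ t
    0≤D {t} t∈D = let x , y , _ , _ , 0<y , x²≈ty = D-elim t∈D in *-cancelˡ-≤ 0<y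
      (≤-by (0≤x² x) (trans x²≈ty (solve 2 (λ t y → t :* y := y :* t :- y :* :0) refl t y)))

    -- Scaling both coordinates by `ƛ` multiplies x²/y by `ƛ`; for the converse below, scaling y
    -- alone divides it by `ƛ`.
    D-ƛ* : ∀ {t} → t ∈ D F → ƛ * t ∈ D F
    D-ƛ* {t} t∈D = let x , y , x∈F , y∈F , 0<y , x²≈ty = D-elim t∈D in
      D-intro (F-left x∈F) (F-left y∈F) (0<ƛ ⊠ 0<y) (begin
        ƛ * x * (ƛ * x)     ≈⟨ solve 2 (λ l x → l :* x :* (l :* x) := l :* l :* (x :* x)) refl ƛ x ⟩
        ƛ * ƛ * (x * x)     ≈⟨ *-congˡ x²≈ty ⟩
        ƛ * ƛ * (t * y)     ≈⟨ solve 3 (λ l t y → l :* l :* (t :* y) := l :* t :* (l :* y)) refl ƛ t y ⟩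
        ƛ * t * (ƛ * y)     ∎)
      where open import Relation.Binary.Reasoning.Setoid setoid

    D-ƛ*⁻ : ∀ {t} → ƛ * t ∈ D F → t ∈ D F
    D-ƛ*⁻ {t} ƛt∈D = let x , y , x∈F , y∈F , 0<y , x²≈ƛty = D-elim ƛt∈D in
      D-intro x∈F (F-left y∈F) (0<ƛ ⊠ 0<y)
        (trans x²≈ƛty (solve 3 (λ l t y → l :* t :* y := t :* (l :* y)) refl ƛ t y))

    -- ƛ ≥ 1/3 gives (1 - ƛ)³ ≤ ƛ, so that the interval of ratio∈D contains a
    -- fundamental domain for the multiplication by ƛ.
    module _ (1≤3ƛ : 1# ≤ 3# * ƛ) where

      wide : 1# - 2# * ƛ ≤ 2# * ƛ * (1# - ƛ)
      wide = ≤-by (≤-diff 1≤3ƛ ⊕ proj₁ 0<ƛ ⊗ proj₁ 0<1-2ƛ)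
        (solve 1 (λ l → :3 :* l :- :1 :+ l :* (:1 :- :2 :* l) :=
          :2 :* l :* (:1 :- l) :- (:1 :- :2 :* l)) refl ƛ)

      α : ℝ
      α = (1# - ƛ) * (1# - ƛ)

      α[1-ƛ]≤ƛ : α * (1# - ƛ) ≤ ƛ
      α[1-ƛ]≤ƛ = ≤-by (0≤ƛ ⊗ 0≤ƛ ⊗ 0≤ƛ ⊕ 0≤ƛ ⊗ 0≤1-ƛ ⊗ ≤-diff 1≤3ƛ ⊕ 0≤1-ƛ ⊗ 0≤1-ƛ ⊗ ≤-diff 1≤3ƛ)
        (solve 1 (λ l → l :* l :* l :+ l :* (:1 :- l) :* (:3 :* l :- :1) :+
          (:1 :- l) :* (:1 :- l) :* (:3 :* l :- :1) :=
          l :- (:1 :- l) :* (:1 :- l) :* (:1 :- l)) refl ƛ)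
        where
        0≤ƛ   = proj₁ 0<ƛ
        0≤1-ƛ = proj₁ 0<1-ƛ

      -- For t < α the quotient t/ƛ still satisfies the upper condition, because α(1 - ƛ) ≤ ƛ; `n`
      -- bounds the number of divisions. In `scale-down` the same inequality keeps ƛt ≥ α once t(1 -
      -- ƛ) > 1.
      scale-up : ∀ n t → α * ƛ ^ n ≤ t → t * (1# - ƛ) ≤ 1# → t ∈ D F
      scale-up zero t t-lower t-upper = ratio∈D wide t (inj₂ 1≤3ƛ)
        (≤-respˡ (solve 1 (λ a → a :* :1 := a) refl α) t-lower) t-upper
      scale-up (suc n) t t-lower t-upper with ≤∨> α t
      ... | inj₁ α≤t = ratio∈D wide t (inj₂ 1≤3ƛ) α≤t t-upper
      ... | inj₂ t<α = D-resp ƛz≈t (D-ƛ* (scale-up n z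
          (*-cancelˡ-≤ 0<ƛ (≤-respʳ (sym ƛz≈t) (≤-respˡ
            (solve 3 (λ a l d → a :* (l :* d) := l :* (a :* d)) refl α ƛ (ƛ ^ n)) t-lower)))
          (*-cancelˡ-≤ 0<ƛ (≤-respˡ (sym ƛz[1-ƛ]≈)
            (≤-respʳ (solve 1 (λ l → l := l :* :1) refl ƛ)
              (≤-trans (*-monoˡ-≤ (proj₁ 0<1-ƛ) (proj₁ t<α))
                (≤-respˡ (*-comm α (1# - ƛ)) α[1-ƛ]≤ƛ)))))))
        where
        z : ℝ
        z = t / ƛ

        ƛz≈t : ƛ * z ≈ t
        ƛz≈t = *-/-cancel t (0<⇒≉0 0<ƛ)

        ƛz[1-ƛ]≈ : ƛ * (z * (1# - ƛ)) ≈ (1# - ƛ) * t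
        ƛz[1-ƛ]≈ = trans (solve 2 (λ l z → l :* (z :* (:1 :- l)) := (:1 :- l) :* (l :* z)) refl ƛ z)
          (*-congˡ ƛz≈t)

      scale-down : ∀ n t → α ≤ t → t * (1# - ƛ) * ƛ ^ n ≤ 1# → t ∈ D F
      scale-down zero t t-lower t-upper = ratio∈D wide t (inj₂ 1≤3ƛ) t-lower
        (≤-respˡ (solve 2 (λ l t → t :* (:1 :- l) :* :1 := t :* (:1 :- l)) refl ƛ t) t-upper)
      scale-down (suc n) t t-lower t-upper with ≤∨> (t * (1# - ƛ)) 1#
      ... | inj₁ t-upper′ = ratio∈D wide t (inj₂ 1≤3ƛ) t-lower t-upper′
      ... | inj₂ 1<t[1-ƛ] = D-ƛ*⁻ (scale-down n (ƛ * t)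
        (*-cancelˡ-≤ 0<1-ƛ (≤-by (≤-diff α[1-ƛ]≤ƛ ⊕ proj₁ (0<ƛ ⊠ <-diff 1<t[1-ƛ]))
          (solve 3 (λ l a t → l :- a :* (:1 :- l) :+ l :* (t :* (:1 :- l) :- :1) :=
            (:1 :- l) :* (l :* t) :- (:1 :- l) :* a) refl ƛ α t)))
        (≤-respˡ (solve 3 (λ l t d → t :* (:1 :- l) :* (l :* d) := l :* t :* (:1 :- l) :* d)
          refl ƛ t (ƛ ^ n)) t-upper))

      nonNegative⇒∈D : ∀ t → 0# ≤ t → t ∈ D F
      nonNegative⇒∈D t 0≤t with ≤∨> t 0# | ≤∨> α t
      ... | inj₁ t≤0 | _ = D-intro 0∈F 1∈F 0<1
        (trans (solve 0 (:0 :* :0 := :0 :* :1) refl) (*-congʳ (antisym 0≤t t≤0)))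
      ... | inj₂ _   | inj₁ α≤t = let n , small = c*^-small (t * (1# - ƛ)) 0<1 in
        scale-down n t α≤t (proj₁ small)
      ... | inj₂ 0<t | inj₂ t<α = let n , small = c*^-small α 0<t in
        scale-up n t (proj₁ small) (≤-trans (≤-reflexive (*-comm t (1# - ƛ)))
          (≤-trans (*-monoˡ-≤ (proj₁ 0<1-ƛ) (proj₁ t<α))
            (≤-trans (≤-reflexive (*-comm (1# - ƛ) α)) (≤-trans α[1-ƛ]≤ƛ (proj₁ ƛ<1)))))

    D-contains-interval : 1# - 2# * ƛ ≤ 2# * ƛ * (1# - ƛ) →
      ∃[ a ] ∃[ b ] (a < b × (∀ t → a ≤ t → t ≤ b → t ∈ D F))
    -- The interval is [1 , 1/(1 - ƛ)]: 1 is at least (1 - ƛ)², and at least 2(1 - 2ƛ) because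
    -- `wide` implies 4ƛ ≥ 1.
    D-contains-interval wide = 1# , b , 1<b , λ t 1≤t t≤b → ratio∈D wide t
      (inj₁ (≤-trans (≤-by (≤-diff wide ⊕ proj₁ 0<2 ⊗ 0≤ƛ ⊗ 0≤ƛ)
        (solve 1 (λ l → :2 :* l :* (:1 :- l) :- (:1 :- :2 :* l) :+ :2 :* l :* l :=
          :1 :- :2 :* (:1 :- :2 :* l)) refl ƛ)) 1≤t))
      (≤-trans (≤-by (0≤ƛ ⊗ (proj₁ 0<1 ⊕ proj₁ 0<1-ƛ))
        (solve 1 (λ l → l :* (:1 :+ (:1 :- l)) := :1 :- (:1 :- l) :* (:1 :- l)) refl ƛ)) 1≤t)
      (≤-respʳ [1-ƛ]b≈1 (≤-respˡ (*-comm (1# - ƛ) t) (*-monoˡ-≤ (proj₁ 0<1-ƛ) t≤b)))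
      where
      0≤ƛ = proj₁ 0<ƛ

      b : ℝ
      b = 1# / (1# - ƛ)

      [1-ƛ]b≈1 : (1# - ƛ) * b ≈ 1#
      [1-ƛ]b≈1 = *-/-cancel 1# (0<⇒≉0 0<1-ƛ)

      1<b : 1# < b
      1<b = *-cancelˡ-< 0<1-ƛ (<-by 0<ƛ
        (trans (solve 1 (λ l → l := :1 :- (:1 :- l) :* :1) refl ƛ) (+-congʳ (sym [1-ƛ]b≈1))))

    -- The set of squares

    -- Any open interval in [0 , 1] that misses `F` counts, maximal or not.
    record Gap (p q : ℝ) : Set where
      field
        0≤p    : 0# ≤ p
        p≤q    : p ≤ q
        q≤1    : q ≤ 1#
        avoids : ∀ x → x ∈ F → p < x → x < q → ⊥

    -- Used with z = 0 and z = 1 - ƛ, so that both maps of the system are treated at once: a gap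
    -- inside the image of [0 , 1] is pulled back to a gap longer by the factor 1/ƛ.
    magnify : ∀ {p q} z → (∀ {x} → x ∈ F → ƛ * x + z ∈ F) → z ≤ p → q ≤ ƛ + z → Gap p q →
      ∃[ p′ ] ∃[ q′ ] (Gap p′ q′ × q - p ≈ ƛ * (q′ - p′))
    magnify {p} {q} z F-z z≤p q≤ƛ+z gap = p′ , q′ , gap′ , length
      where
      open Gap gap

      p′ q′ : ℝ
      p′ = (p - z) / ƛ
      q′ = (q - z) / ƛ

      ƛp′ : ƛ * p′ ≈ p - z
      ƛp′ = *-/-cancel (p - z) (0<⇒≉0 0<ƛ)

      ƛq′ : ƛ * q′ ≈ q - z
      ƛq′ = *-/-cancel (q - z) (0<⇒≉0 0<ƛ)

      length : q - p ≈ ƛ * (q′ - p′)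
      length = trans (solve 3 (λ p q z → q :- p := q :- z :- (p :- z)) refl p q z)
        (trans (+-cong (sym ƛq′) (-‿cong (sym ƛp′)))
          (solve 3 (λ l p q → l :* q :- l :* p := l :* (q :- p)) refl ƛ p′ q′))

      gap′ : Gap p′ q′
      gap′ = record
        { 0≤p    = *-cancelˡ-≤ 0<ƛ (≤-respʳ (sym ƛp′)
            (≤-respˡ (solve 1 (λ l → :0 := l :* :0) refl ƛ) (≤-diff z≤p)))
        ; p≤q    = *-cancelˡ-≤ 0<ƛ (≤-by (≤-diff p≤q) (trans length
            (solve 3 (λ l p q → l :* (q :- p) := l :* q :- l :* p) refl ƛ p′ q′)))
        ; q≤1    = *-cancelˡ-≤ 0<ƛ (≤-respˡ (sym ƛq′) (≤-by (≤-diff q≤ƛ+z)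
            (solve 3 (λ l q z → l :+ z :- q := l :* :1 :- (q :- z)) refl ƛ q z)))
        ; avoids = λ x x∈F p′<x x<q′ → avoids (ƛ * x + z) (F-z x∈F)
            (<-by (0<ƛ ⊠ <-diff p′<x) (trans
              (solve 3 (λ l p x → l :* (x :- p) := l :* x :- l :* p) refl ƛ p′ x)
              (trans (+-congˡ (-‿cong ƛp′))
                (solve 4 (λ l p x z → l :* x :- (p :- z) := l :* x :+ z :- p) refl ƛ p x z))))
            (<-by (0<ƛ ⊠ <-diff x<q′) (trans
              (solve 3 (λ l q x → l :* (q :- x) := l :* q :- l :* x) refl ƛ q′ x)
              (trans (+-congʳ ƛq′)
                (solve 4 (λ l q x z → q :- z :- l :* x := q :- (l :* x :+ z)) refl ƛ q x z))))
        }

    -- Since `ƛ` and 1 - ƛ belong to `F`, no gap contains either point, so a gap lies in the central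
    -- one or inside one of the two outer pieces.
    classify : ∀ {p q} → Gap p q → (ƛ ≤ p × q ≤ 1# - ƛ) ⊎
      (∃[ p′ ] ∃[ q′ ] (Gap p′ q′ × q - p ≈ ƛ * (q′ - p′)))
    classify {p} {q} gap with ≤∨> ƛ p | ≤∨> q (1# - ƛ)
    ... | inj₁ ƛ≤p | inj₁ q≤1-ƛ = inj₁ (ƛ≤p , q≤1-ƛ)
    ... | inj₂ p<ƛ | _ = inj₂ (magnify 0#
      (λ {x} x∈F → F-resp (solve 2 (λ l x → l :* x := l :* x :+ :0) refl ƛ x) (F-left x∈F))
      0≤p (≤-respʳ (solve 1 (λ l → l := l :+ :0) refl ƛ) (≮⇒≥ (avoids ƛ ƛ∈F p<ƛ))) gap)
      where open Gap gap
    ... | inj₁ _ | inj₂ 1-ƛ<q = inj₂ (magnify (1# - ƛ) F-right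
      (≮⇒≥ λ p<1-ƛ → avoids (1# - ƛ) 1-ƛ∈F p<1-ƛ 1-ƛ<q)
      (≤-respʳ (solve 1 (λ l → :1 := l :+ (:1 :- l)) refl ƛ) q≤1) gap)
      where open Gap gap

    -- By `classify`, every gap length is at most 1 - 2ƛ or at most ƛs, where s is the supremum of
    -- the lengths. If ƛs were the larger bound, then s ≤ ƛs with s > 0, which is impossible.
    gap-length≤ : ∀ {p q} → Gap p q → q - p ≤ 1# - 2# * ƛ
    gap-length≤ {p} {q} gap = ≤-trans (s-upper (q - p) (p , q , gap , refl)) s≤1-2ƛ
      where
      S : Pred ℝ 0ℓ
      S l = ∃[ p ] ∃[ q ] (Gap p q × l ≈ q - p)

      sup : ∃[ s ] Supremum S s
      sup = complete S (q - p , p , q , gap , refl)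
        (1# , λ { l (p , q , gap , l≈) → ≤-respˡ (sym l≈)
          (≤-by (≤-diff (Gap.q≤1 gap) ⊕ Gap.0≤p gap)
            (solve 2 (λ p q → :1 :- q :+ p := :1 :- (q :- p)) refl p q)) })

      s       = proj₁ sup
      s-upper = proj₁ (proj₂ sup)
      s-least = proj₂ (proj₂ sup)

      upper-bound : ∀ m → 1# - 2# * ƛ ≤ m → ƛ * s ≤ m → UpperBound S m
      upper-bound m 1-2ƛ≤m ƛs≤m l (p , q , gap , l≈) = ≤-respˡ (sym l≈) (by-class (classify gap))
        where
        by-class : _ ⊎ _ → q - p ≤ m
        by-class (inj₁ (ƛ≤p , q≤1-ƛ)) = ≤-trans (≤-by (≤-diff ƛ≤p ⊕ ≤-diff q≤1-ƛ)
          (solve 3 (λ l p q → p :- l :+ (:1 :- l :- q) := :1 :- :2 :* l :- (q :- p)) refl ƛ p q))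
          1-2ƛ≤m
        by-class (inj₂ (p′ , q′ , gap′ , length)) = ≤-respˡ (sym length)
          (≤-trans (*-monoˡ-≤ (proj₁ 0<ƛ) (s-upper (q′ - p′) (p′ , q′ , gap′ , refl))) ƛs≤m)

      s≤1-2ƛ : s ≤ 1# - 2# * ƛ
      s≤1-2ƛ with ≤∨> (ƛ * s) (1# - 2# * ƛ)
      ... | inj₁ ƛs≤ = s-least (1# - 2# * ƛ) (upper-bound (1# - 2# * ƛ) ≤-refl ƛs≤)
      ... | inj₂ <ƛs = absurd
        (0<1-ƛ ⊠ <-≤-trans 0<1-2ƛ (proj₁ <ƛs) ⊞
          proj₁ 0<ƛ ⊗ ≤-diff (s-least (ƛ * s) (upper-bound (ƛ * s) (proj₁ <ƛs) ≤-refl)))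
        (solve 2 (λ l s → (:1 :- l) :* (l :* s) :+ l :* (l :* s :- s) := :0) refl ƛ s)

    central∨short : ∀ {p q} → Gap p q → (ƛ ≤ p × q ≤ 1# - ƛ) ⊎ q - p ≤ ƛ * (1# - 2# * ƛ)
    central∨short gap = map₂
      (λ { (p′ , q′ , gap′ , length) →
           ≤-respˡ (sym length) (*-monoˡ-≤ (proj₁ 0<ƛ) (gap-length≤ gap′)) })
      (classify gap)

    -- Square roots turn a gap (c , d) of the squares into a gap (p , q) of `F`. If that gap is not
    -- central, then d - c = (q - p)(q + p) ≤ 2ƛ(1 - 2ƛ) < 1 - 2ƛ.
    squares-central-gap : ∀ {c d} → 0# ≤ c → c ≤ d → d ≤ 1# →
      (∀ u → u ∈ F → c < u * u → u * u < d → ⊥) → 1# - 2# * ƛ ≤ d - c →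
      ƛ * ƛ ≤ c × d ≤ (1# - ƛ) * (1# - ƛ)
    squares-central-gap {c} {d} 0≤c c≤d d≤1 avoids long = by-class (central∨short gap)
      where
      √c = sqrt c 0≤c
      √d = sqrt d (≤-trans 0≤c c≤d)

      p    = proj₁ √c
      q    = proj₁ √d
      0≤p  = proj₁ (proj₂ √c)
      0≤q  = proj₁ (proj₂ √d)
      p²≈c = proj₂ (proj₂ √c)
      q²≈d = proj₂ (proj₂ √d)

      gap : Gap p q
      gap = record
        { 0≤p    = 0≤p
        ; p≤q    = ²-cancel-≤ 0≤q (≤-respˡ (sym p²≈c) (≤-respʳ (sym q²≈d) c≤d))
        ; q≤1    = ²-cancel-≤ (proj₁ 0<1)
            (≤-respˡ (sym q²≈d) (≤-respʳ (solve 0 (:1 := :1 :* :1) refl) d≤1))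
        ; avoids = λ x x∈F p<x x<q → avoids x x∈F
            (≤-<-trans (≤-reflexive (sym p²≈c)) (²-mono-< 0≤p p<x))
            (<-≤-trans (²-mono-< (0≤F x x∈F) x<q) (≤-reflexive q²≈d))
        }
      open Gap gap using (p≤q; q≤1)

      by-class : (ƛ ≤ p × q ≤ 1# - ƛ) ⊎ q - p ≤ ƛ * (1# - 2# * ƛ) →
        ƛ * ƛ ≤ c × d ≤ (1# - ƛ) * (1# - ƛ)
      by-class (inj₁ (ƛ≤p , q≤1-ƛ)) =
        ≤-respʳ p²≈c (²-mono-≤ (proj₁ 0<ƛ) ƛ≤p) , ≤-respˡ q²≈d (²-mono-≤ 0≤q q≤1-ƛ)
      by-class (inj₂ short) = absurd
        (0<1-2ƛ ⊠ 0<1-2ƛ ⊞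
          ((0≤q ⊕ 0≤p) ⊗ ≤-diff short ⊕
           (≤-diff q≤1 ⊕ ≤-diff (≤-trans p≤q q≤1)) ⊗ (proj₁ 0<ƛ ⊗ proj₁ 0<1-2ƛ) ⊕
           ≤-diff (≤-respʳ (+-cong (sym q²≈d) (-‿cong (sym p²≈c))) long)))
        (solve 3 (λ l p q →
          (:1 :- :2 :* l) :* (:1 :- :2 :* l) :+
          ((q :+ p) :* (l :* (:1 :- :2 :* l) :- (q :- p)) :+
           (:1 :- q :+ (:1 :- p)) :* (l :* (:1 :- :2 :* l)) :+
           (q :* q :- p :* p :- (:1 :- :2 :* l))) := :0) refl ƛ p q)

    -- The ends of the middle gap of [1 - δ , 1], the rightmost basic interval of length `δ` when δ
    -- = ƛⁿ.
    gapˡ gapʳ : ℝ → ℝ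
    gapˡ δ = 1# - δ + ƛ * δ
    gapʳ δ = 1# - ƛ * δ

    rightmost-gaps : ∀ n x → x ∈ F → x ≤ gapˡ (ƛ ^ n) ⊎ gapʳ (ƛ ^ n) ≤ x
    rightmost-gaps n x x∈F = split n (F-split x∈F)
      where
      split : ∀ n {x} → ∃[ z ] (z ∈ F × (x ≈ ƛ * z ⊎ x ≈ ƛ * z + (1# - ƛ))) →
        x ≤ gapˡ (ƛ ^ n) ⊎ gapʳ (ƛ ^ n) ≤ x
      split zero (z , z∈F , inj₁ x≈) = inj₁ (≤-respˡ (sym x≈)
        (≤-by (proj₁ 0<ƛ ⊗ ≤-diff (F≤1 z z∈F))
          (solve 2 (λ l z → l :* (:1 :- z) := :1 :- :1 :+ l :* :1 :- l :* z) refl ƛ z)))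
      split zero (z , z∈F , inj₂ x≈) = inj₂ (≤-respʳ (sym x≈)
        (≤-by (proj₁ 0<ƛ ⊗ 0≤F z z∈F)
          (solve 2 (λ l z → l :* z := l :* z :+ (:1 :- l) :- (:1 :- l :* :1)) refl ƛ z)))
      split (suc n) (z , z∈F , inj₁ x≈) = inj₁ (≤-respˡ (sym x≈)
        (≤-by (proj₁ 0<ƛ ⊗ ≤-diff (F≤1 z z∈F) ⊕ proj₁ 0<1-2ƛ ⊕
               proj₁ 0<ƛ ⊗ ≤-diff (^-≤1 n) ⊕ proj₁ 0<ƛ ⊗ proj₁ (^-pos (suc n)))
          (solve 3 (λ l d z → l :* (:1 :- z) :+ (:1 :- :2 :* l) :+ l :* (:1 :- d) :+ l :* (l :* d) :=
            :1 :- l :* d :+ l :* (l :* d) :- l :* z) refl ƛ (ƛ ^ n) z)))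
      split (suc n) {x} (z , z∈F , inj₂ x≈) with split n (F-split z∈F)
      ... | inj₁ z≤ = inj₁ (≤-respˡ (sym x≈) (≤-by (proj₁ 0<ƛ ⊗ ≤-diff z≤)
        (solve 3 (λ l d z → l :* (:1 :- d :+ l :* d :- z) :=
          :1 :- l :* d :+ l :* (l :* d) :- (l :* z :+ (:1 :- l))) refl ƛ (ƛ ^ n) z)))
      ... | inj₂ ≤z = inj₂ (≤-respʳ (sym x≈) (≤-by (proj₁ 0<ƛ ⊗ ≤-diff ≤z)
        (solve 3 (λ l d z → l :* (z :- (:1 :- l :* d)) :=
          l :* z :+ (:1 :- l) :- (:1 :- l :* (l :* d))) refl ƛ (ƛ ^ n) z)))

    no-square-in-gap : ∀ n v → v ∈ F →
      gapˡ (ƛ ^ n) * gapˡ (ƛ ^ n) < v * v → v * v < gapʳ (ƛ ^ n) * gapʳ (ƛ ^ n) → ⊥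
    no-square-in-gap n v v∈F lower upper with rightmost-gaps n v v∈F
    ... | inj₁ v≤ = ≤∧<⇒⊥ (²-mono-≤ (0≤F v v∈F) v≤) lower
    ... | inj₂ ≤v = ≤∧<⇒⊥ (²-mono-≤ 0≤gapʳ ≤v) upper
      where
      0≤gapʳ : 0# ≤ gapʳ (ƛ ^ n)
      0≤gapʳ = ≤-diff (^-≤1 (suc n))

    -- If a similarity of ratio ±ρ maps the squares of F into themselves, with 1
    -- an endpoint of the image, and δ = ƛⁿ is such that the image lies in
    -- [(1 - δ)² , 1] but not in [(1 - ƛδ)² , 1], then the gap
    -- (gapˡ δ ² , gapʳ δ ²) lies between the endpoints 1 - ρ and 1 of the image;
    -- γ and η are its distances to 1, in units of ρ.
    record Pullback (ρ δ : ℝ) : Set where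
      field
        γ η      : ℝ
        ργ       : ρ * γ ≈ 1# - gapˡ δ * gapˡ δ
        ρη       : ρ * η ≈ 1# - gapʳ δ * gapʳ δ
        0≤η      : 0# ≤ η
        η≤γ      : η ≤ γ
        γ≤1      : γ ≤ 1#
        1-2ƛ≤γ-η : 1# - 2# * ƛ ≤ γ - η

    -- With L = δ(2 - δ), the length of [(1 - δ)² , 1], the gap has length (1 - 2ƛ)L. As ρ ≤ L, its
    -- length in units of `ρ` is at least 1 - 2ƛ.
    pull-back : ∀ {ρ} n → 0# < ρ → ρ ≤ ƛ ^ n * (2# - ƛ ^ n) →
      1# - ρ ≤ gapˡ (ƛ ^ n) * gapˡ (ƛ ^ n) → Pullback ρ (ƛ ^ n)
    pull-back {ρ} n 0<ρ ρ≤ 1-ρ≤ = record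
      { γ        = γ
      ; η        = η
      ; ργ       = ργ
      ; ρη       = ρη
      ; 0≤η      = *-cancelˡ-≤ 0<ρ (≤-by
          (proj₁ 0<ƛ ⊗ proj₁ 0<δ ⊗ (proj₁ 0<1 ⊕ ≤-diff (^-≤1 (suc n))))
          (trans (solve 3 (λ r l d → l :* d :* (:1 :+ (:1 :- l :* d)) :=
              :1 :- (:1 :- l :* d) :* (:1 :- l :* d) :- r :* :0) refl ρ ƛ δ)
            (+-congʳ (sym ρη))))
      ; η≤γ      = *-cancelˡ-≤ 0<ρ (≤-by
          (proj₁ 0<1-2ƛ ⊗ (proj₁ 0<δ ⊗ (proj₁ 0<1 ⊕ ≤-diff (^-≤1 n))))
          (trans (solve 2 (λ l d → (:1 :- :2 :* l) :* (d :* (:1 :+ (:1 :- d))) :=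
              (:1 :- :2 :* l) :* (d :* (:2 :- d))) refl ƛ δ) [1-2ƛ]L≈))
      ; γ≤1      = *-cancelˡ-≤ 0<ρ (≤-by (≤-diff 1-ρ≤)
          (trans (solve 2 (λ r a → a :* a :- (:1 :- r) := r :* :1 :- (:1 :- a :* a)) refl ρ (gapˡ δ))
            (+-congˡ (-‿cong (sym ργ)))))
      ; 1-2ƛ≤γ-η = *-cancelˡ-≤ 0<ρ (≤-by (proj₁ 0<1-2ƛ ⊗ ≤-diff ρ≤)
          (trans (solve 3 (λ r l d → (:1 :- :2 :* l) :* (d :* (:2 :- d) :- r) :=
              (:1 :- :2 :* l) :* (d :* (:2 :- d)) :- r :* (:1 :- :2 :* l)) refl ρ ƛ δ)
            (+-congʳ (trans [1-2ƛ]L≈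
              (solve 3 (λ r g e → r :* g :- r :* e := r :* (g :- e)) refl ρ γ η)))))
      }
      where
      δ : ℝ
      δ = ƛ ^ n

      0<δ : 0# < δ
      0<δ = ^-pos n

      γ η : ℝ
      γ = (1# - gapˡ δ * gapˡ δ) / ρ
      η = (1# - gapʳ δ * gapʳ δ) / ρ

      ργ : ρ * γ ≈ 1# - gapˡ δ * gapˡ δ
      ργ = *-/-cancel _ (0<⇒≉0 0<ρ)

      ρη : ρ * η ≈ 1# - gapʳ δ * gapʳ δ
      ρη = *-/-cancel _ (0<⇒≉0 0<ρ)

      -- Relative to [(1 - δ)² , 1], this gap is as long as the central one.
      [1-2ƛ]L≈ : (1# - 2# * ƛ) * (δ * (2# - δ)) ≈ ρ * γ - ρ * η
      [1-2ƛ]L≈ = trans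
        (solve 2 (λ l d → (:1 :- :2 :* l) :* (d :* (:2 :- d)) :=
          :1 :- (:1 :- d :+ l :* d) :* (:1 :- d :+ l :* d) :-
          (:1 :- (:1 :- l :* d) :* (:1 :- l :* d))) refl ƛ δ)
        (sym (+-cong ργ (-‿cong ρη)))

    NoPullback : ℝ → Set
    NoPullback ρ = ∀ n → ρ ≤ ƛ ^ n * (2# - ƛ ^ n) → 1# - ρ ≤ gapˡ (ƛ ^ n) * gapˡ (ƛ ^ n) → ⊥

    -- `v * v` is the far endpoint of the image. `NoPullback` forbids `v` to lie left of the n-th
    -- gap, so v ≥ 1 - ƛⁿ⁺¹, which carries the bound on `ρ` from n to n + 1.
    ratio-not-positive : ∀ {ρ v} → ρ ≤ 1# → v ∈ F → v * v ≈ 1# - ρ → NoPullback ρ → ρ ≤ 0#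
    ratio-not-positive {ρ} {v} ρ≤1 v∈F v²≈ no-pullback = ≤c*^⇒≤0 ρ 2# λ n → ≤-trans (bound n)
        (≤-by (0≤x² (ƛ ^ n)) (solve 1 (λ d → d :* d := :2 :* d :- d :* (:2 :- d)) refl (ƛ ^ n)))
      where
      bound : ∀ n → ρ ≤ ƛ ^ n * (2# - ƛ ^ n)
      bound zero = ≤-respʳ (solve 0 (:1 := :1 :* (:2 :- :1)) refl) ρ≤1
      bound (suc n) with rightmost-gaps n v v∈F
      ... | inj₁ v≤ = ⊥-elim (no-pullback n (bound n) (≤-respˡ v²≈ (²-mono-≤ (0≤F v v∈F) v≤)))
      ... | inj₂ ≤v = ≤-by (≤-diff (≤-respʳ v²≈ (²-mono-≤ (≤-diff (^-≤1 (suc n))) ≤v)))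
        (solve 2 (λ r d → :1 :- r :- (:1 :- d) :* (:1 :- d) := d :* (:2 :- d) :- r) refl ρ (ƛ ^ suc n))

    increasing-impossible : ∀ {ρ} → 0# < ρ → ρ < 1# →
      (∀ u → u ∈ F → ∃[ v ] (v ∈ F × v * v ≈ 1# - ρ * (1# - u * u))) → ⊥
    increasing-impossible {ρ} 0<ρ ρ<1 image = ≤∧<⇒⊥
        (ratio-not-positive (proj₁ ρ<1) (proj₁ (proj₂ image₀))
          (trans (proj₂ (proj₂ image₀)) (solve 1 (λ r → :1 :- r :* (:1 :- :0 :* :0) := :1 :- r) refl ρ))
          impossible)
        0<ρ
      where
      image₀ = image 0# 0∈F

      impossible : NoPullback ρ
      -- The pulled-back gap lies in the central one. Comparing lengths gives L = δ(2 - δ) ≤ ρ;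
      -- comparing right ends gives ƛδ(2 - ƛδ) = ρη ≥ ρƛ(2 - ƛ). Together they yield 2(1 - ƛ)(1 - δ)
      -- ≤ 0, although δ < 1.
      impossible n ρ≤ 1-ρ≤ = absurd
          (0<1-ƛ ⊠ (0<ƛ ⊠ (0<δ ⊠ (0<2 ⊠ 0<1-δ))) ⊞
            (0≤2-ƛ ⊗ proj₁ 0<ƛ ⊗ ≤-diff L≤ρ ⊕ proj₁ 0<ρ ⊗ ≤-diff d≤))
          (trans (+-congˡ (+-congˡ (trans
              (solve 3 (λ r l e → r :* ((:1 :- l) :* (:1 :- l) :- (:1 :- e)) :=
                r :* e :- r :* (:2 :- l) :* l) refl ρ ƛ η)
              (+-congʳ ρη))))
            (solve 3 (λ r l d →
              (:1 :- l) :* (l :* (d :* (:2 :* (:1 :- d)))) :+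
              ((:2 :- l) :* l :* (r :- d :* (:2 :- d)) :+
               (:1 :- (:1 :- l :* d) :* (:1 :- l :* d) :- r :* (:2 :- l) :* l)) := :0) refl ρ ƛ δ))
        where
        open Pullback (pull-back n 0<ρ ρ≤ 1-ρ≤)

        δ : ℝ
        δ = ƛ ^ n

        0<δ : 0# < δ
        0<δ = ^-pos n

        avoids : ∀ u → u ∈ F → 1# - γ < u * u → u * u < 1# - η → ⊥
        avoids u u∈F lower upper = let v , v∈F , v²≈ = image u u∈F in
          no-square-in-gap n v v∈F
            (<-by (0<ρ ⊠ <-diff lower) (trans
              (solve 3 (λ r g u → r :* (u :* u :- (:1 :- g)) :=
                r :* g :- r :* (:1 :- u :* u)) refl ρ γ u)
              (trans (+-congʳ ργ) (trans
                (solve 3 (λ r a u → :1 :- a :* a :- r :* (:1 :- u :* u) :=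
                  :1 :- r :* (:1 :- u :* u) :- a :* a) refl ρ (gapˡ δ) u)
                (+-congʳ (sym v²≈))))))
            (<-by (0<ρ ⊠ <-diff upper) (trans
              (solve 3 (λ r e u → r :* (:1 :- e :- u :* u) :=
                r :* (:1 :- u :* u) :- r :* e) refl ρ η u)
              (trans (+-congˡ (-‿cong ρη)) (trans
                (solve 3 (λ r b u → r :* (:1 :- u :* u) :- (:1 :- b :* b) :=
                  b :* b :- (:1 :- r :* (:1 :- u :* u))) refl ρ (gapʳ δ) u)
                (+-congˡ (-‿cong (sym v²≈)))))))

        central : ƛ * ƛ ≤ 1# - γ × 1# - η ≤ (1# - ƛ) * (1# - ƛ)
        central = squares-central-gap (≤-diff γ≤1)
          (≤-by (≤-diff η≤γ) (solve 2 (λ g e → g :- e := :1 :- e :- (:1 :- g)) refl γ η))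
          (≤-by 0≤η (solve 1 (λ e → e := :1 :- (:1 :- e)) refl η))
          avoids
          (≤-respʳ (solve 2 (λ g e → g :- e := :1 :- e :- (:1 :- g)) refl γ η) 1-2ƛ≤γ-η)

        d≤ = proj₂ central

        L≤ρ : δ * (2# - δ) ≤ ρ
        L≤ρ = *-cancelˡ-≤ 0<1-2ƛ (≤-by (proj₁ 0<ρ ⊗ (≤-diff (proj₁ central) ⊕ ≤-diff d≤))
          (trans
            (solve 4 (λ r l g e → r :* (:1 :- g :- l :* l :+ ((:1 :- l) :* (:1 :- l) :- (:1 :- e))) :=
              (:1 :- :2 :* l) :* r :- (r :* g :- r :* e)) refl ρ ƛ γ η)
            (+-congˡ (-‿cong (trans (+-cong ργ (-‿cong ρη))
              (solve 2 (λ l d →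
                :1 :- (:1 :- d :+ l :* d) :* (:1 :- d :+ l :* d) :-
                (:1 :- (:1 :- l :* d) :* (:1 :- l :* d)) :=
                (:1 :- :2 :* l) :* (d :* (:2 :- d))) refl ƛ δ))))))

        0<1-δ : 0# < 1# - δ
        0<1-δ with ≤∨> 1# δ
        -- δ = 1 would make L = 1, against L ≤ ρ < 1.
        ... | inj₁ 1≤δ = ⊥-elim (≤∧<⇒⊥ (≤-trans (≤-by (≤-diff (^-≤1 n) ⊗ ≤-diff 1≤δ)
          (solve 1 (λ d → (:1 :- d) :* (d :- :1) := d :* (:2 :- d) :- :1) refl δ)) L≤ρ) ρ<1)
        ... | inj₂ δ<1 = <-diff δ<1

        0≤2-ƛ : 0# ≤ 2# - ƛ
        0≤2-ƛ = ≤-by (proj₁ 0<1 ⊕ proj₁ 0<1-ƛ)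
          (solve 1 (λ l → :1 :+ (:1 :- l) := :2 :- l :- :0) refl ƛ)

    decreasing-impossible : ∀ {ρ} → 0# < ρ → ρ < 1# →
      (∀ u → u ∈ F → ∃[ v ] (v ∈ F × v * v ≈ 1# - ρ * (u * u))) → ⊥
    decreasing-impossible {ρ} 0<ρ ρ<1 image = ≤∧<⇒⊥
        (ratio-not-positive (proj₁ ρ<1) (proj₁ (proj₂ image₁))
          (trans (proj₂ (proj₂ image₁)) (solve 1 (λ r → :1 :- r :* (:1 :* :1) := :1 :- r) refl ρ))
          impossible)
        0<ρ
      where
      image₁ = image 1# 1∈F

      impossible : NoPullback ρ
      -- The orientation is reversed, so `γ` is now the right end of the pulled-back gap. With a = 1
      -- - ƛ, aδ(2 - aδ) = ργ ≤ ρa² ≤ δ(2 - δ)a², which reduces to 2ƛ ≤ 0.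
      impossible n ρ≤ 1-ρ≤ = absurd
          (0<δ ⊠ (0<1-ƛ ⊠ (0<2 ⊠ 0<ƛ)) ⊞
            (proj₁ 0<1-ƛ ⊗ proj₁ 0<1-ƛ ⊗ ≤-diff ρ≤ ⊕ proj₁ 0<ρ ⊗ ≤-diff (proj₂ central)))
          (trans (+-congˡ (+-congˡ (trans
              (solve 3 (λ r l g → r :* ((:1 :- l) :* (:1 :- l) :- g) :=
                r :* ((:1 :- l) :* (:1 :- l)) :- r :* g) refl ρ ƛ γ)
              (+-congˡ (-‿cong ργ)))))
            (solve 3 (λ r l d →
              d :* ((:1 :- l) :* (:2 :* l)) :+
              ((:1 :- l) :* (:1 :- l) :* (d :* (:2 :- d) :- r) :+
               (r :* ((:1 :- l) :* (:1 :- l)) :-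
                (:1 :- (:1 :- d :+ l :* d) :* (:1 :- d :+ l :* d)))) := :0) refl ρ ƛ δ))
        where
        open Pullback (pull-back n 0<ρ ρ≤ 1-ρ≤)

        δ : ℝ
        δ = ƛ ^ n

        0<δ : 0# < δ
        0<δ = ^-pos n

        avoids : ∀ u → u ∈ F → η < u * u → u * u < γ → ⊥
        avoids u u∈F lower upper = let v , v∈F , v²≈ = image u u∈F in
          no-square-in-gap n v v∈F
            (<-by (0<ρ ⊠ <-diff upper) (trans
              (solve 3 (λ r g u → r :* (g :- u :* u) := r :* g :- r :* (u :* u)) refl ρ γ u)
              (trans (+-congʳ ργ) (trans
                (solve 3 (λ r a u → :1 :- a :* a :- r :* (u :* u) :=
                  :1 :- r :* (u :* u) :- a :* a) refl ρ (gapˡ δ) u)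
                (+-congʳ (sym v²≈))))))
            (<-by (0<ρ ⊠ <-diff lower) (trans
              (solve 3 (λ r e u → r :* (u :* u :- e) := r :* (u :* u) :- r :* e) refl ρ η u)
              (trans (+-congˡ (-‿cong ρη)) (trans
                (solve 3 (λ r b u → r :* (u :* u) :- (:1 :- b :* b) :=
                  b :* b :- (:1 :- r :* (u :* u))) refl ρ (gapʳ δ) u)
                (+-congˡ (-‿cong (sym v²≈)))))))

        central : ƛ * ƛ ≤ η × γ ≤ (1# - ƛ) * (1# - ƛ)
        central = squares-central-gap 0≤η η≤γ γ≤1 avoids 1-2ƛ≤γ-η

    squares≤1 : ∀ {y} → y ∈ squares F → y ≤ 1#
    squares≤1 (u , u∈F , y≈u²) = ≤-respˡ (sym y≈u²)
      (≤-respʳ (solve 0 (:1 :* :1 := :1) refl) (²-mono-≤ (0≤F u u∈F) (F≤1 u u∈F)))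

    0≤squares : ∀ {y} → y ∈ squares F → 0# ≤ y
    0≤squares (u , u∈F , y≈u²) = ≤-respʳ (sym y≈u²) (0≤x² u)

    0∈squares : 0# ∈ squares F
    0∈squares = 0# , 0∈F , solve 0 (:0 := :0 :* :0) refl

    1∈squares : 1# ∈ squares F
    1∈squares = 1# , 1∈F , solve 0 (:1 := :1 :* :1) refl

    -- 1 is the largest square, so a monotone map of the squares into themselves that reaches 1 does
    -- so at an extreme point: at 1 if r > 0, at 0 if r < 0. This determines `b` and leaves the two
    -- normal forms excluded above.
    no-similarity-onto-1 : ∀ {r b x} → 0# < ∣ r ∣ → ∣ r ∣ < 1# →
      (∀ {y} → y ∈ squares F → r * y + b ∈ squares F) →
      x ∈ squares F → 1# ≈ r * x + b → ⊥
    no-similarity-onto-1 {r} {b} {x} 0<∣r∣ ∣r∣<1 into x∈ 1≈ with ≤∨> r 0# | ≤∨> 0# r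
    ... | inj₁ r≤0 | inj₁ 0≤r = ≤∧<⇒⊥ (⊔-lub r≤0
      (≤-by 0≤r (solve 1 (λ r → r := :0 :- :- r) refl r))) 0<∣r∣
    ... | inj₂ 0<r | _ = increasing-impossible 0<r (∣x∣<ε⇒x<ε ∣r∣<1) λ u u∈F →
        let v , v∈F , ≈v² = into (u , u∈F , refl) in
        v , v∈F , trans (sym ≈v²) (trans
          (solve 3 (λ r b w → r :* w :+ b := r :* :1 :+ b :- r :* (:1 :- w)) refl r b (u * u))
          (+-congʳ r+b≈1))
      where
      r+b≈1 : r * 1# + b ≈ 1#
      r+b≈1 = antisym (squares≤1 (into 1∈squares)) (≤-respˡ (sym 1≈)
        (≤-by (proj₁ 0<r ⊗ ≤-diff (squares≤1 x∈))
          (solve 3 (λ r b x → r :* (:1 :- x) := r :* :1 :+ b :- (r :* x :+ b)) refl r b x)))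
    ... | inj₁ _ | inj₂ r<0 = decreasing-impossible
        (<-by (<-diff r<0) (solve 1 (λ r → :0 :- r := :- r :- :0) refl r)) (∣x∣<ε⇒-x<ε ∣r∣<1) λ u u∈F →
        let v , v∈F , ≈v² = into (u , u∈F , refl) in
        v , v∈F , trans (sym ≈v²) (trans
          (solve 3 (λ r b w → r :* w :+ b := r :* :0 :+ b :- (:- r) :* w) refl r b (u * u))
          (+-congʳ b≈1))
      where
      b≈1 : r * 0# + b ≈ 1#
      b≈1 = antisym (squares≤1 (into 0∈squares)) (≤-respˡ (sym 1≈)
        (≤-by (≤-diff (proj₁ r<0) ⊗ 0≤squares x∈)
          (solve 3 (λ r b x → (:0 :- r) :* x := r :* :0 :+ b :- (r :* x :+ b)) refl r b x)))

    not-self-similar : ¬ SelfSimilar (squares F)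
    not-self-similar (n , r , b , _ , ratios , _ , _ , squares≐) =
      let i , x , x∈ , 1≈ = proj₁ squares≐ 1∈squares in
      no-similarity-onto-1 (proj₁ (ratios i)) (proj₂ (ratios i))
        (λ {y} y∈ → proj₂ squares≐ (i , y , y∈ , refl)) x∈ 1≈

theorem1p1 : ExcludedMiddle 0ℓ →
    (R : CompleteOrderedField) →
    let open CompleteOrderedField R renaming (Carrier to ℝ)
        open Fractal R
    in
    (ƛ : ℝ) → 0# < ƛ → ƛ < 1# / 2# →
    (F : Pred ℝ 0ℓ) → IsCantorSet ƛ F →
    ¬ SelfSimilar (squares F)
    × (1# / 3# ≤ ƛ → Empty (K F) × D F ≐ (λ t → 0# ≤ t))
    × ((√2 : ℝ) → IsSqrt 2# √2 → (2# - √2) / 2# ≤ ƛ →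
        ∃[ a ] ∃[ b ] (a < b × (∀ t → a ≤ t → t ≤ b → t ∈ D F)))
theorem1p1 em R ƛ 0<ƛ ƛ<½ F isCantorSet =
    not-self-similar , D-full , λ √2 √2-sqrt ≤ƛ → D-contains-interval (wide-of-√2 √2 √2-sqrt ≤ƛ)
  where
  open OrderedField em R
  open Fractal R
  open CompactSets em R
  open CantorSet ƛ 0<ƛ ƛ<½ F isCantorSet

  D-full : 1# / 3# ≤ ƛ → Empty (K F) × D F ≐ (λ t → 0# ≤ t)
  D-full ⅓≤ƛ = (λ k (0≤k , k∉D) → k∉D (nonNegative⇒∈D 1≤3ƛ k 0≤k)) ,
    0≤D , λ {t} → nonNegative⇒∈D 1≤3ƛ t
    where
    1≤3ƛ : 1# ≤ 3# * ƛ
    1≤3ƛ = ≤-respˡ (*-/-cancel 1# (0<⇒≉0 0<3)) (*-monoˡ-≤ (proj₁ 0<3) ⅓≤ƛ)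

  -- The goal rearranges to 2(1 - ƛ)² ≤ 1. Its certificate factors s² - (2(1 - ƛ))², where s² = 2,
  -- as a difference of squares.
  wide-of-√2 : ∀ s → IsSqrt 2# s → (2# - s) / 2# ≤ ƛ → 1# - 2# * ƛ ≤ 2# * ƛ * (1# - ƛ)
  wide-of-√2 s (0≤s , s²≈2) [2-s]/2≤ƛ = *-cancelˡ-≤ 0<2
    (≤-by (≤-diff 2-s≤2ƛ ⊗ (0≤s ⊕ proj₁ 0<2 ⊗ proj₁ 0<1-ƛ)) (trans
      (solve 2 (λ l s → (:2 :* l :- (:2 :- s)) :* (s :+ :2 :* (:1 :- l)) :=
        s :* s :- (:2 :* (:1 :- l)) :* (:2 :* (:1 :- l))) refl ƛ s)
      (trans (+-congʳ s²≈2)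
        (solve 1 (λ l → :2 :- (:2 :* (:1 :- l)) :* (:2 :* (:1 :- l)) :=
          :2 :* (:2 :* l :* (:1 :- l)) :- :2 :* (:1 :- :2 :* l)) refl ƛ))))
    where
    2-s≤2ƛ : 2# - s ≤ 2# * ƛ
    2-s≤2ƛ = ≤-respˡ (*-/-cancel (2# - s) (0<⇒≉0 0<2)) (*-monoˡ-≤ (proj₁ 0<2) [2-s]/2≤ƛ)
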